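{- For every odd integer $d\ge 3$ and every prime power $q\ge d+2$, $$M(q+1,q-d)\ \ge\ \mathcal{T}_d(q).$$
   Context: For permutations $\pi,\sigma$ of the same $n$ symbols, the Hamming distance $hd(\pi,\sigma)$ is the number of positions $x$ with $\pi(x)\ne\sigma(x)$. $M(n,D)$ is the maximum size of a set of permutations on $n$ symbols in which any two distinct permutations have Hamming distance at least $D$. Let $q$ be a prime power, $\mathbb{F}_q$ the field with $q$ elements and $\mathcal{P}^1(\mathbb{F}_q)=\mathbb{F}_q\cup\{\infty\}$. Let $V,U$ be nonzero polynomials over $\mathbb{F}_q$ with $\gcd(V,U)=1$, of degrees $v,u$ and leading coefficients $a_v,b_u$. The rational function $V(x)/U(x)$ is evaluated on $\mathcal{P}^1(\mathbb{F}_q)$ as follows: at $a\in\mathbb{F}_q$ its value is $V(a)/U(a)$, understood as $\infty$ if $U(a)=0$; at $\infty$ its value is $\infty$ if $v>u$, $0$ if $v<u$, and $a_v/b_v$ if $v=u$. It is a permutation rational function (PRF) if it permutes $\mathcal{P}^1(\mathbb{F}_q)$. $P_{v,u}(q)$ is the set of PRFs $V(x)/U(x)$ (as rational functions, so $V/U$ and $(cV)/(cU)$ with $c\in\mathbb{F}_q\setminus\{0\}$ are the same element) with $\deg V=v$ and $\deg U=u$, and $N_{v,u}(q)=|P_{v,u}(q)|$. For odd $d$, $\mathcal{T}_d(q)=\sum N_{v,u}(q)$, the sum being over all pairs $(v,u)$ with $0\le v,u\le (d+1)/2$. -}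

module Defs where

open import Algebra.Bundles using (CommutativeRing; Semiring)
import Algebra.Definitions.RawMagma as RawMagmaDefs
import Algebra.Definitions.RawSemiring as RawSemiringDefs
open import Algebra.Structures using (IsCommutativeRing)
open import Data.Empty using (⊥-elim)
open import Data.Fin.Base using (Fin; zero; suc; finToFun; funToFin)
import Data.Fin.Permutation as Perm
open Perm using (Permutation′; _⟨$⟩ʳ_)
import Data.Fin.Properties as Finₚ
open import Data.List.Base using (List; []; _∷_; length; map; filter; allFin; lookup; deduplicate; upTo; cartesianProductWith; cartesianProduct)
open import Data.List.Membership.Propositional using (_∈_; find)
open import Data.List.Membership.Propositional.Properties using (∈-lookup; ∈-allFin; ∈-cartesianProduct⁺)
open import Data.List.Relation.Unary.All as All using (All; all?)
open import Data.List.Relation.Unary.AllPairs using (_∷_)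
open import Data.List.Relation.Unary.Any as Any using (Any; here; there; any?)
import Data.List.Relation.Unary.Any.Properties as Anyₚ
open import Data.List.Relation.Unary.Enumerates.Setoid using (IsEnumeration)
import Data.List.Relation.Unary.Enumerates.Setoid.Properties as Enum
open import Data.List.Relation.Unary.Unique.DecSetoid.Properties using (deduplicate-!)
open import Data.List.Relation.Unary.Unique.Setoid using (Unique)
open import Data.Maybe.Base using (just; nothing)
import Data.Maybe.Relation.Binary.Pointwise as Maybe
open import Data.Nat.Base as ℕ using (ℕ; zero; suc; _≤_; _<_; z≤n; s≤s)
open import Data.Nat.DivMod using (_/_)
open import Data.Nat.ListAction using (sum)
open import Data.Nat.Primality using (Prime)
import Data.Nat.Properties as ℕₚ
open import Data.Product.Base using (Σ; ∃; ∃₂; _×_; _,_; proj₁; proj₂)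
open import Data.Sum.Base using (_⊎_; inj₁; inj₂)
open import Function.Base using (_∘_)
open import Function.Bundles using (Inverse; Injection; mk⤖)
open import Function.Definitions using (Injective; Surjective; Bijective; Congruent)
open import Function.Properties.Bijection using (⤖⇒↔)
open import Function.Properties.Inverse using (↔⇒↣)
open import Level as Level using (Level; _⊔_)
open import Relation.Binary.Bundles using (Setoid; DecSetoid)
open import Relation.Binary.Definitions as Binary using (_Respects_; tri<; tri≈; tri>)
open import Relation.Binary.PropositionalEquality.Core as ≡ using (_≡_)
import Relation.Binary.PropositionalEquality.Properties as ≡ₚ
import Relation.Binary.Reasoning.Setoid as SetoidReasoning
open import Relation.Binary.Structures using (IsEquivalence)
open import Relation.Nullary using (¬_; Dec; yes; no; ¬?)
open import Relation.Nullary.Decidable using (map′; _→-dec_; _×-dec_)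
open import Relation.Unary using (Pred; Decidable)

hd : ∀ {n} → Permutation′ n → Permutation′ n → ℕ
hd {n} π σ = length (filter (λ x → ¬? (π ⟨$⟩ʳ x Finₚ.≟ σ ⟨$⟩ʳ x)) (allFin n))

-- The family perm lists, without repetition, a set of m permutations.
record IsCode {n m : ℕ} (D : ℕ) (perm : Fin m → Permutation′ n) : Set where
  field
    distinct : ∀ i j → perm i Perm.≈ perm j → i ≡ j
    distance : ∀ i j → ¬ (perm i Perm.≈ perm j) → D ≤ hd (perm i) (perm j)

HasCode : (n D m : ℕ) → Set
HasCode n D m = Σ (Fin m → Permutation′ n) (IsCode D)

record IsMaximum {p} (P : Pred ℕ p) (m : ℕ) : Set p where
  field
    attained : P m
    maximal  : ∀ {k} → P k → k ≤ m

maximum-exists : ∀ {p} {P : Pred ℕ p} → Decidable P → P 0 →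
                 ∀ b → (∀ {k} → P k → k ≤ b) → ∃ (IsMaximum P)
maximum-exists P? P0 zero bound = 0 , record { attained = P0 ; maximal = bound }
maximum-exists {P = P} P? P0 (suc b) bound with P? (suc b)
... | yes Pb = suc b , record { attained = Pb ; maximal = bound }
... | no ¬Pb = maximum-exists P? P0 b λ Pk → ℕₚ.≤-pred (ℕₚ.≤∧≢⇒< (bound Pk) (λ { ≡.refl → ¬Pb Pk }))

hd-cong : ∀ {n} {π π′ σ σ′ : Permutation′ n} → π Perm.≈ π′ → σ Perm.≈ σ′ →
          hd π σ ≡ hd π′ σ′
hd-cong {n} {π} {π′} {σ} {σ′} e e′ = go (allFin n)
  where
  go : ∀ xs → length (filter (λ x → ¬? (π ⟨$⟩ʳ x Finₚ.≟ σ ⟨$⟩ʳ x)) xs) ≡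
              length (filter (λ x → ¬? (π′ ⟨$⟩ʳ x Finₚ.≟ σ′ ⟨$⟩ʳ x)) xs)
  go [] = ≡.refl
  go (x ∷ xs) rewrite e x | e′ x with π′ ⟨$⟩ʳ x Finₚ.≟ σ′ ⟨$⟩ʳ x
  ... | yes _ = go xs
  ... | no  _ = ≡.cong suc (go xs)

-- The number of elements up to the setoid equality.
HasSize : ∀ {a ℓ} → Setoid a ℓ → ℕ → Set (a ⊔ ℓ)
HasSize S n = Inverse (≡ₚ.setoid (Fin n)) S

module _ {a ℓ} (S : Setoid a ℓ) where
  open Setoid S

  lookup-injective : ∀ {xs} → Unique S xs → ∀ i j → lookup xs i ≈ lookup xs j → i ≡ j
  lookup-injective (_ ∷ _)  zero    zero    _ = ≡.refl
  lookup-injective {_ ∷ xs} (x∉ ∷ _) zero (suc j) e = ⊥-elim (All.lookup x∉ (∈-lookup {xs = xs} j) e)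
  lookup-injective {_ ∷ xs} (x∉ ∷ _) (suc i) zero e = ⊥-elim (All.lookup x∉ (∈-lookup {xs = xs} i) (sym e))
  lookup-injective (_ ∷ u)  (suc i) (suc j) e = ≡.cong suc (lookup-injective u i j e)

module _ {a ℓ} (S : DecSetoid a ℓ) where
  open DecSetoid S

  size-exists : ∀ {xs} → IsEnumeration setoid xs → ∃ (HasSize setoid)
  size-exists {xs} _∈xs = length ys , record
    { to        = lookup ys
    ; from      = λ x → Any.index (x ∈ys)
    ; to-cong   = λ { ≡.refl → refl }
    ; from-cong = from-cong
    ; inverse   = (λ { {x} ≡.refl → sym (Anyₚ.lookup-index (x ∈ys)) })
                , λ {i} {x} e → lookup-injective setoid (deduplicate-! S xs) _ _
                    (trans (sym (Anyₚ.lookup-index (x ∈ys))) e)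
    }
    where
    ys = deduplicate _≟_ xs
    _∈ys = Enum.deduplicate⁺ S _∈xs
    from-cong : ∀ {x y} → x ≈ y → Any.index (x ∈ys) ≡ Any.index (y ∈ys)
    from-cong {x} {y} e = lookup-injective setoid (deduplicate-! S xs) _ _
      (trans (sym (Anyₚ.lookup-index (x ∈ys))) (trans e (Anyₚ.lookup-index (y ∈ys))))

module _ {a ℓ} (S : Setoid a ℓ) {xs} (_∈xs : IsEnumeration S xs)
         {p} {P : Pred (Setoid.Carrier S) p} (resp : P Respects (Setoid._≈_ S)) (P? : Decidable P) where
  open Setoid S

  ∀? : Dec (∀ x → P x)
  ∀? = map′ (λ ps x → All.lookupₛ S resp ps (x ∈xs)) (λ ps → All.tabulate (λ {x} _ → ps x)) (all? P? xs)

  ∃? : Dec (∃ P)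
  ∃? = map′ Any.satisfied (λ (x , px) → Any.map (λ e → resp e px) (x ∈xs)) (any? P? xs)

module _ {a ℓ} (S : DecSetoid a ℓ) {xs} (enum : IsEnumeration (DecSetoid.setoid S) xs) where
  open DecSetoid S

  bijective? : ∀ {f} → Congruent _≈_ _≈_ f → Dec (Bijective _≈_ _≈_ f)
  bijective? {f} cong = injective? ×-dec surjective?
    where
    injective? : Dec (Injective _≈_ _≈_ f)
    injective? = map′ (λ inj {x} {y} → inj x y) (λ inj x y → inj)
      (∀? setoid enum (λ e inj y q → trans (sym e) (inj y (trans (cong e) q)))
        λ x → ∀? setoid enum (λ e inj q → trans (inj (trans q (sym (cong e)))) e)
        λ y → (f x ≟ f y) →-dec (x ≟ y))
    surjective? : Dec (Surjective _≈_ _≈_ f)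
    surjective? = map′
      (λ sur y → proj₁ (sur y) , λ q → trans (cong q) (proj₂ (sur y)))
      (λ sur y → proj₁ (sur y) , proj₂ (sur y) refl)
      (∀? setoid enum (λ e (x , q) → x , trans q e)
        λ y → ∃? setoid enum (λ e q → trans (sym (cong e)) q) λ x → f x ≟ y)

module _ {a p} {A : Set a} {P : Pred A p} (P? : Decidable P) where

  collect : List A → List (∃ P)
  collect [] = []
  collect (x ∷ xs) with P? x
  ... | yes px = (x , px) ∷ collect xs
  ... | no  _  = collect xs

  collect-complete : ∀ {x xs} → x ∈ xs → P x → Any (λ y → proj₁ y ≡ x) (collect xs)
  collect-complete {xs = y ∷ _} (here ≡.refl) px with P? y
  ... | yes _  = here ≡.refl
  ... | no ¬py = ⊥-elim (¬py px)
  collect-complete {xs = y ∷ _} (there x∈) px with P? y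
  ... | yes _  = there (collect-complete x∈ px)
  ... | no  _  = collect-complete x∈ px

finToFun-cong : ∀ {m n} {f g : Fin n → Fin m} → (∀ x → f x ≡ g x) →
                ∀ x → f x ≡ finToFun (funToFin g) x
finToFun-cong {g = g} e x = ≡.trans (e x) (≡.sym (Finₚ.finToFun-funToFin g x))

permutations : ℕ → DecSetoid _ _
permutations n = record
  { Carrier = Permutation′ n
  ; _≈_     = Perm._≈_
  ; isDecEquivalence = record
    { isEquivalence = record
      { refl  = λ _ → ≡.refl
      ; sym   = λ e x → ≡.sym (e x)
      ; trans = λ e e′ x → ≡.trans (e x) (e′ x)
      }
    ; _≟_ = λ π σ → Finₚ.all? λ x → π ⟨$⟩ʳ x Finₚ.≟ σ ⟨$⟩ʳ x
    }
  }

permutations-finite : ∀ n → ∃ (HasSize (DecSetoid.setoid (permutations n)))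
permutations-finite n = size-exists (permutations n) complete
  where
  IsBijective : Pred (Fin (n ℕ.^ n)) _
  IsBijective k = Bijective _≡_ _≡_ (finToFun {n} {n} k)
  isBijective? : Decidable IsBijective
  isBijective? k = bijective? (≡ₚ.decSetoid Finₚ._≟_) ∈-allFin (≡.cong (finToFun {n} {n} k))
  toPerm : ∃ IsBijective → Permutation′ n
  toPerm (k , bij) = ⤖⇒↔ (mk⤖ bij)
  complete : IsEnumeration (DecSetoid.setoid (permutations n)) (map toPerm (collect isBijective? (allFin (n ℕ.^ n))))
  complete π = Anyₚ.map⁺ (Any.map (λ { {k , _} ≡.refl → toFin })
      (collect-complete isBijective? (∈-allFin (funToFin (π ⟨$⟩ʳ_))) bij))
    where
    toFin : ∀ x → π ⟨$⟩ʳ x ≡ finToFun (funToFin (π ⟨$⟩ʳ_)) x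
    toFin = finToFun-cong λ _ → ≡.refl
    bij : IsBijective (funToFin (π ⟨$⟩ʳ_))
    bij = (λ {x} {y} e → Injection.injective (↔⇒↣ π) (≡.trans (toFin x) (≡.trans e (≡.sym (toFin y)))))
        , λ y → (π Perm.⟨$⟩ˡ y) , λ { ≡.refl → ≡.trans (≡.sym (toFin _)) (Perm.inverseʳ π) }

module _ (n D : ℕ) where
  private
    module Perms = DecSetoid (permutations n)
    count = proj₁ (permutations-finite n)
    open Inverse (proj₂ (permutations-finite n))

  isCode? : ∀ {m} (perm : Fin m → Permutation′ n) → Dec (IsCode D perm)
  isCode? perm = map′
    (λ (d , D≤) → record { distinct = d ; distance = D≤ })
    (λ c → IsCode.distinct c , IsCode.distance c)
    ((Finₚ.all? λ i → Finₚ.all? λ j → (perm i Perms.≟ perm j) →-dec (i Finₚ.≟ j)) ×-dec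
     (Finₚ.all? λ i → Finₚ.all? λ j → ¬? (perm i Perms.≟ perm j) →-dec (D ℕₚ.≤? hd (perm i) (perm j))))

  isCode-resp : ∀ {m} {f g : Fin m → Permutation′ n} → (∀ i → f i Perms.≈ g i) →
                IsCode D f → IsCode D g
  isCode-resp {f = f} {g} e c = record
    { distinct = λ i j q → distinct i j (back i j q)
    ; distance = λ i j q → ≡.subst (D ≤_)
        (hd-cong {π = f i} {g i} {f j} {g j} (e i) (e j))
        (distance i j λ q′ → q
          (Perms.trans {g i} {f i} {g j} (Perms.sym {f i} {g i} (e i)) (Perms.trans {f i} {f j} {g j} q′ (e j))))
    }
    where
    open IsCode c
    back : ∀ i j → g i Perms.≈ g j → f i Perms.≈ f j
    back i j q = Perms.trans {f i} {g i} {f j} (e i) (Perms.trans {g i} {g j} {f j} q (Perms.sym {f j} {g j} (e j)))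

  hasCode? : Decidable (HasCode n D)
  hasCode? m = map′
    (λ (k , c) → to ∘ finToFun {count} {m} k , c)
    (λ (f , c) → funToFin (from ∘ f) , isCode-resp (λ i → Perms.sym {to (finToFun (funToFin (from ∘ f)) i)} {f i}
        (inverseˡ (≡.sym (finToFun-cong {f = from ∘ f} (λ _ → ≡.refl) i)))) c)
    (Finₚ.any? λ k → isCode? (to ∘ finToFun {count} {m} k))

  hasCode-bound : ∀ {m} → HasCode n D m → m ≤ count
  hasCode-bound (f , c) = Finₚ.injective⇒≤ {f = from ∘ f} λ {i} {j} e → IsCode.distinct c i j
    (Perms.trans {f i} {to (from (f i))} {f j}
      (Perms.sym {to (from (f i))} {f i} (inverseˡ ≡.refl)) (inverseˡ e))

  -- M is characterised by M-exists: some code of size M exists, none is larger.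
  M-exists : ∃ (IsMaximum (HasCode n D))
  M-exists = maximum-exists hasCode?
    ((λ ()) , record { distinct = λ () ; distance = λ () }) count hasCode-bound

  M : ℕ
  M = proj₁ M-exists

module Polynomials {c ℓ} (R : CommutativeRing c ℓ) where
  open CommutativeRing R
  open import Algebra.Properties.Ring ring using (-0#≈0#)
  open import Algebra.Properties.CommutativeSemigroup +-commutativeSemigroup
    using (interchange)
  open SetoidReasoning setoid

  -- Coefficients in increasing order of degree, trailing zeros allowed.
  Poly : Set c
  Poly = List Carrier

  coeff : Poly → ℕ → Carrier
  coeff []      _       = 0#
  coeff (a ∷ p) zero    = a
  coeff (a ∷ p) (suc n) = coeff p n

  infix 4 _≈ₚ_
  record _≈ₚ_ (p q : Poly) : Set ℓ where
    constructor mk≈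
    field coeff≈ : ∀ n → coeff p n ≈ coeff q n
  open _≈ₚ_ public

  infixl 6 _+ₚ_
  infixl 7 _*ₚ_ _·ₚ_
  infix  8 -ₚ_

  _+ₚ_ : Poly → Poly → Poly
  []      +ₚ q       = q
  (a ∷ p) +ₚ []      = a ∷ p
  (a ∷ p) +ₚ (b ∷ q) = a + b ∷ p +ₚ q

  -ₚ_ : Poly → Poly
  -ₚ_ = map (-_)

  _·ₚ_ : Carrier → Poly → Poly
  a ·ₚ p = map (a *_) p

  _*ₚ_ : Poly → Poly → Poly
  []      *ₚ q = []
  (a ∷ p) *ₚ q = a ·ₚ q +ₚ (0# ∷ p *ₚ q)

  1ₚ : Poly
  1ₚ = 1# ∷ []

  eval : Poly → Carrier → Carrier
  eval []      x = 0#
  eval (a ∷ p) x = a + x * eval p x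

  coeff-+ : ∀ p q n → coeff (p +ₚ q) n ≈ coeff p n + coeff q n
  coeff-+ []      q       n       = sym (+-identityˡ _)
  coeff-+ (a ∷ p) []      n       = sym (+-identityʳ _)
  coeff-+ (a ∷ p) (b ∷ q) zero    = refl
  coeff-+ (a ∷ p) (b ∷ q) (suc n) = coeff-+ p q n

  coeff-neg : ∀ p n → coeff (-ₚ p) n ≈ - coeff p n
  coeff-neg []      n       = sym -0#≈0#
  coeff-neg (a ∷ p) zero    = refl
  coeff-neg (a ∷ p) (suc n) = coeff-neg p n

  coeff-· : ∀ a p n → coeff (a ·ₚ p) n ≈ a * coeff p n
  coeff-· a []      n       = sym (zeroʳ a)
  coeff-· a (b ∷ p) zero    = refl
  coeff-· a (b ∷ p) (suc n) = coeff-· a p n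

  ≈ₚ-isEquivalence : IsEquivalence _≈ₚ_
  ≈ₚ-isEquivalence = record
    { refl  = mk≈ λ _ → refl
    ; sym   = λ e → mk≈ λ n → sym (coeff≈ e n)
    ; trans = λ e e′ → mk≈ λ n → trans (coeff≈ e n) (coeff≈ e′ n)
    }

  open IsEquivalence ≈ₚ-isEquivalence public
    using () renaming (refl to ≈ₚ-refl; sym to ≈ₚ-sym; trans to ≈ₚ-trans)

  polySetoid : Setoid c ℓ
  polySetoid = record { isEquivalence = ≈ₚ-isEquivalence }

  module ≈ₚ-Reasoning = SetoidReasoning polySetoid

  ∷-cong : ∀ {a b p q} → a ≈ b → p ≈ₚ q → a ∷ p ≈ₚ b ∷ q
  ∷-cong e e′ = mk≈ λ { zero → e ; (suc n) → coeff≈ e′ n }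

  0∷[] : 0# ∷ [] ≈ₚ []
  0∷[] = mk≈ λ { zero → refl ; (suc n) → refl }

  +ₚ-cong : ∀ {p p′ q q′} → p ≈ₚ p′ → q ≈ₚ q′ → p +ₚ q ≈ₚ p′ +ₚ q′
  +ₚ-cong {p} {p′} {q} {q′} e e′ = mk≈ λ n →
    trans (coeff-+ p q n) (trans (+-cong (coeff≈ e n) (coeff≈ e′ n)) (sym (coeff-+ p′ q′ n)))

  +ₚ-assoc : ∀ p q r → (p +ₚ q) +ₚ r ≈ₚ p +ₚ (q +ₚ r)
  +ₚ-assoc p q r = mk≈ λ n → begin
    coeff ((p +ₚ q) +ₚ r) n             ≈⟨ coeff-+ (p +ₚ q) r n ⟩
    coeff (p +ₚ q) n + coeff r n        ≈⟨ +-congʳ (coeff-+ p q n) ⟩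
    coeff p n + coeff q n + coeff r n   ≈⟨ +-assoc _ _ _ ⟩
    coeff p n + (coeff q n + coeff r n) ≈⟨ +-congˡ (coeff-+ q r n) ⟨
    coeff p n + coeff (q +ₚ r) n        ≈⟨ coeff-+ p (q +ₚ r) n ⟨
    coeff (p +ₚ (q +ₚ r)) n             ∎

  +ₚ-comm : ∀ p q → p +ₚ q ≈ₚ q +ₚ p
  +ₚ-comm p q = mk≈ λ n → trans (coeff-+ p q n) (trans (+-comm _ _) (sym (coeff-+ q p n)))

  +ₚ-identityʳ : ∀ p → p +ₚ [] ≈ₚ p
  +ₚ-identityʳ p = +ₚ-comm p []

  -ₚ-cong : ∀ {p q} → p ≈ₚ q → -ₚ p ≈ₚ -ₚ q
  -ₚ-cong {p} {q} e = mk≈ λ n →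
    trans (coeff-neg p n) (trans (-‿cong (coeff≈ e n)) (sym (coeff-neg q n)))

  -ₚ-inverseˡ : ∀ p → -ₚ p +ₚ p ≈ₚ []
  -ₚ-inverseˡ p = mk≈ λ n →
    trans (coeff-+ (-ₚ p) p n) (trans (+-congʳ (coeff-neg p n)) (-‿inverseˡ _))

  ·ₚ-cong : ∀ {a b p q} → a ≈ b → p ≈ₚ q → a ·ₚ p ≈ₚ b ·ₚ q
  ·ₚ-cong {a} {b} {p} {q} e e′ = mk≈ λ n →
    trans (coeff-· a p n) (trans (*-cong e (coeff≈ e′ n)) (sym (coeff-· b q n)))

  ·ₚ-distribˡ : ∀ a p q → a ·ₚ (p +ₚ q) ≈ₚ a ·ₚ p +ₚ a ·ₚ q
  ·ₚ-distribˡ a p q = mk≈ λ n → begin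
    coeff (a ·ₚ (p +ₚ q)) n               ≈⟨ coeff-· a (p +ₚ q) n ⟩
    a * coeff (p +ₚ q) n                  ≈⟨ *-congˡ (coeff-+ p q n) ⟩
    a * (coeff p n + coeff q n)           ≈⟨ distribˡ _ _ _ ⟩
    a * coeff p n + a * coeff q n         ≈⟨ +-cong (coeff-· a p n) (coeff-· a q n) ⟨
    coeff (a ·ₚ p) n + coeff (a ·ₚ q) n   ≈⟨ coeff-+ (a ·ₚ p) (a ·ₚ q) n ⟨
    coeff (a ·ₚ p +ₚ a ·ₚ q) n            ∎

  ·ₚ-distribʳ : ∀ p a b → (a + b) ·ₚ p ≈ₚ a ·ₚ p +ₚ b ·ₚ p
  ·ₚ-distribʳ p a b = mk≈ λ n → begin
    coeff ((a + b) ·ₚ p) n                ≈⟨ coeff-· (a + b) p n ⟩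
    (a + b) * coeff p n                   ≈⟨ distribʳ _ _ _ ⟩
    a * coeff p n + b * coeff p n         ≈⟨ +-cong (coeff-· a p n) (coeff-· b p n) ⟨
    coeff (a ·ₚ p) n + coeff (b ·ₚ p) n   ≈⟨ coeff-+ (a ·ₚ p) (b ·ₚ p) n ⟨
    coeff (a ·ₚ p +ₚ b ·ₚ p) n            ∎

  ·ₚ-assoc : ∀ a b p → (a * b) ·ₚ p ≈ₚ a ·ₚ (b ·ₚ p)
  ·ₚ-assoc a b p = mk≈ λ n → begin
    coeff ((a * b) ·ₚ p) n   ≈⟨ coeff-· (a * b) p n ⟩
    a * b * coeff p n        ≈⟨ *-assoc _ _ _ ⟩
    a * (b * coeff p n)      ≈⟨ *-congˡ (coeff-· b p n) ⟨
    a * coeff (b ·ₚ p) n     ≈⟨ coeff-· a (b ·ₚ p) n ⟨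
    coeff (a ·ₚ (b ·ₚ p)) n  ∎

  1·ₚ : ∀ p → 1# ·ₚ p ≈ₚ p
  1·ₚ p = mk≈ λ n → trans (coeff-· 1# p n) (*-identityˡ _)

  0·ₚ : ∀ p → 0# ·ₚ p ≈ₚ []
  0·ₚ p = mk≈ λ n → trans (coeff-· 0# p n) (zeroˡ _)

  +ₚ-interchange : ∀ p q r s → (p +ₚ q) +ₚ (r +ₚ s) ≈ₚ (p +ₚ r) +ₚ (q +ₚ s)
  +ₚ-interchange p q r s = mk≈ λ n → begin
    coeff ((p +ₚ q) +ₚ (r +ₚ s)) n                          ≈⟨ coeff-+ (p +ₚ q) (r +ₚ s) n ⟩
    coeff (p +ₚ q) n + coeff (r +ₚ s) n                     ≈⟨ +-cong (coeff-+ p q n) (coeff-+ r s n) ⟩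
    (coeff p n + coeff q n) + (coeff r n + coeff s n)       ≈⟨ interchange _ _ _ _ ⟩
    (coeff p n + coeff r n) + (coeff q n + coeff s n)       ≈⟨ +-cong (coeff-+ p r n) (coeff-+ q s n) ⟨
    coeff (p +ₚ r) n + coeff (q +ₚ s) n                     ≈⟨ coeff-+ (p +ₚ r) (q +ₚ s) n ⟨
    coeff ((p +ₚ r) +ₚ (q +ₚ s)) n                          ∎

  *ₚ-zeroʳ : ∀ p → p *ₚ [] ≈ₚ []
  *ₚ-zeroʳ []      = ≈ₚ-refl
  *ₚ-zeroʳ (a ∷ p) = ≈ₚ-trans (∷-cong refl (*ₚ-zeroʳ p)) 0∷[]

  *ₚ-congˡ : ∀ p {q r} → q ≈ₚ r → p *ₚ q ≈ₚ p *ₚ r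
  *ₚ-congˡ []      e = ≈ₚ-refl
  *ₚ-congˡ (a ∷ p) {q} {r} e = +ₚ-cong (·ₚ-cong {p = q} {r} refl e) (∷-cong refl (*ₚ-congˡ p e))

  ∷-as-+ : ∀ a p → a ∷ p ≈ₚ (a ∷ []) +ₚ (0# ∷ p)
  ∷-as-+ a p = ∷-cong (sym (+-identityʳ a)) ≈ₚ-refl

  +ₚ-left-comm : ∀ p q r → p +ₚ (q +ₚ r) ≈ₚ q +ₚ (p +ₚ r)
  +ₚ-left-comm p q r = ≈ₚ-trans (≈ₚ-sym (+ₚ-assoc p q r))
    (≈ₚ-trans (+ₚ-cong (+ₚ-comm p q) ≈ₚ-refl) (+ₚ-assoc q p r))

  *ₚ-∷ʳ : ∀ p a q → p *ₚ (a ∷ q) ≈ₚ a ·ₚ p +ₚ (0# ∷ p *ₚ q)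
  *ₚ-∷ʳ []      a q = ≈ₚ-sym 0∷[]
  *ₚ-∷ʳ (b ∷ p) a q = ∷-cong (+-congʳ (*-comm b a)) (≈ₚ-trans
    (+ₚ-cong (≈ₚ-refl {b ·ₚ q}) (*ₚ-∷ʳ p a q)) (+ₚ-left-comm (b ·ₚ q) (a ·ₚ p) (0# ∷ p *ₚ q)))

  *ₚ-comm : ∀ p q → p *ₚ q ≈ₚ q *ₚ p
  *ₚ-comm []      q = ≈ₚ-sym (*ₚ-zeroʳ q)
  *ₚ-comm (a ∷ p) q = ≈ₚ-trans (+ₚ-cong (≈ₚ-refl {a ·ₚ q}) (∷-cong refl (*ₚ-comm p q))) (≈ₚ-sym (*ₚ-∷ʳ q a p))

  *ₚ-cong : ∀ {p p′ q q′} → p ≈ₚ p′ → q ≈ₚ q′ → p *ₚ q ≈ₚ p′ *ₚ q′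
  *ₚ-cong {p} {p′} {q} {q′} e e′ = ≈ₚ-trans (*ₚ-congˡ p e′)
    (≈ₚ-trans (*ₚ-comm p q′) (≈ₚ-trans (*ₚ-congˡ q′ e) (*ₚ-comm q′ p′)))

  *ₚ-distribʳ : ∀ r p q → (p +ₚ q) *ₚ r ≈ₚ p *ₚ r +ₚ q *ₚ r
  *ₚ-distribʳ r []      q       = ≈ₚ-refl
  *ₚ-distribʳ r (a ∷ p) []      = ≈ₚ-sym (+ₚ-identityʳ ((a ∷ p) *ₚ r))
  *ₚ-distribʳ r (a ∷ p) (b ∷ q) = ≈ₚ-trans
    (+ₚ-cong (·ₚ-distribʳ r a b) (∷-cong (sym (+-identityʳ 0#)) (*ₚ-distribʳ r p q)))
    (+ₚ-interchange (a ·ₚ r) (b ·ₚ r) (0# ∷ p *ₚ r) (0# ∷ q *ₚ r))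

  *ₚ-distribˡ : ∀ r p q → r *ₚ (p +ₚ q) ≈ₚ r *ₚ p +ₚ r *ₚ q
  *ₚ-distribˡ r p q = ≈ₚ-trans (*ₚ-comm r (p +ₚ q))
    (≈ₚ-trans (*ₚ-distribʳ r p q) (+ₚ-cong (*ₚ-comm p r) (*ₚ-comm q r)))

  ·ₚ-*ₚ : ∀ a p q → (a ·ₚ p) *ₚ q ≈ₚ a ·ₚ (p *ₚ q)
  ·ₚ-*ₚ a []      q = ≈ₚ-refl
  ·ₚ-*ₚ a (b ∷ p) q = ≈ₚ-trans
    (+ₚ-cong (·ₚ-assoc a b q) (∷-cong (sym (zeroʳ a)) (·ₚ-*ₚ a p q)))
    (≈ₚ-sym (·ₚ-distribˡ a (b ·ₚ q) (0# ∷ p *ₚ q)))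

  *ₚ-assoc : ∀ p q r → (p *ₚ q) *ₚ r ≈ₚ p *ₚ (q *ₚ r)
  *ₚ-assoc []      q r = ≈ₚ-refl
  *ₚ-assoc (a ∷ p) q r = ≈ₚ-trans (*ₚ-distribʳ r (a ·ₚ q) (0# ∷ p *ₚ q))
    (+ₚ-cong (·ₚ-*ₚ a q r) (+ₚ-cong (0·ₚ r) (∷-cong refl (*ₚ-assoc p q r))))

  *ₚ-identityˡ : ∀ p → 1ₚ *ₚ p ≈ₚ p
  *ₚ-identityˡ p = ≈ₚ-trans (+ₚ-cong (1·ₚ p) 0∷[]) (+ₚ-identityʳ p)

  polyIsCommutativeRing : IsCommutativeRing _≈ₚ_ _+ₚ_ _*ₚ_ -ₚ_ [] 1ₚ
  polyIsCommutativeRing = record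
    { isRing = record
      { +-isAbelianGroup = record
        { isGroup = record
          { isMonoid = record
            { isSemigroup = record
              { isMagma = record { isEquivalence = ≈ₚ-isEquivalence ; ∙-cong = +ₚ-cong }
              ; assoc = +ₚ-assoc
              }
            ; identity = (λ _ → ≈ₚ-refl) , +ₚ-identityʳ
            }
          ; inverse = -ₚ-inverseˡ , λ p → ≈ₚ-trans (+ₚ-comm p (-ₚ p)) (-ₚ-inverseˡ p)
          ; ⁻¹-cong = -ₚ-cong
          }
        ; comm = +ₚ-comm
        }
      ; *-cong = *ₚ-cong
      ; *-assoc = *ₚ-assoc
      ; *-identity = *ₚ-identityˡ , λ p → ≈ₚ-trans (*ₚ-comm p 1ₚ) (*ₚ-identityˡ p)
      ; distrib = *ₚ-distribˡ , *ₚ-distribʳ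
      }
    ; *-comm = *ₚ-comm
    }

  polyRing : CommutativeRing c ℓ
  polyRing = record { isCommutativeRing = polyIsCommutativeRing }

  eval-cong : ∀ {p q x y} → p ≈ₚ q → x ≈ y → eval p x ≈ eval q y
  eval-cong {[]}    {[]}    e e′ = refl
  eval-cong {[]}    {b ∷ q} {x} {y} e e′ = sym (begin
    b + y * eval q y ≈⟨ +-cong (sym (coeff≈ e 0)) (*-cong (sym e′) (sym (eval-cong {[]} {q} {x} {y} (mk≈ λ n → coeff≈ e (suc n)) e′))) ⟩
    0# + x * 0#      ≈⟨ +-identityˡ _ ⟩
    x * 0#           ≈⟨ zeroʳ _ ⟩
    0#               ∎)
  eval-cong {a ∷ p} {[]}    {x} {y} e e′ = begin
    a + x * eval p x ≈⟨ +-cong (coeff≈ e 0) (*-congˡ (eval-cong {p} {[]} {x} {y} (mk≈ λ n → coeff≈ e (suc n)) e′)) ⟩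
    0# + x * 0#      ≈⟨ +-identityˡ _ ⟩
    x * 0#           ≈⟨ zeroʳ _ ⟩
    0#               ∎
  eval-cong {a ∷ p} {b ∷ q} e e′ =
    +-cong (coeff≈ e 0) (*-cong e′ (eval-cong {p} {q} (mk≈ λ n → coeff≈ e (suc n)) e′))

  record HasDegree (p : Poly) (n : ℕ) : Set ℓ where
    constructor mkDegree
    field
      leading≉0 : coeff p n ≉ 0#
      above≈0   : ∀ {m} → n < m → coeff p m ≈ 0#
  open HasDegree public

  hasDegree-cong : ∀ {p q n} → p ≈ₚ q → HasDegree p n → HasDegree q n
  hasDegree-cong e (mkDegree lead high) = mkDegree
    (λ z → lead (trans (coeff≈ e _) z)) λ n<m → trans (sym (coeff≈ e _)) (high n<m)

  *ₚ-high : ∀ {p q i j} → (∀ {m} → i < m → coeff p m ≈ 0#) → (∀ {m} → j < m → coeff q m ≈ 0#) →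
            ∀ {m} → i ℕ.+ j < m → coeff (p *ₚ q) m ≈ 0#
  *ₚ-lead : ∀ {p q i j} → (∀ {m} → i < m → coeff p m ≈ 0#) → (∀ {m} → j < m → coeff q m ≈ 0#) →
            coeff (p *ₚ q) (i ℕ.+ j) ≈ coeff p i * coeff q j

  *ₚ-tail≈0 : ∀ {p} q → (∀ {m} → 0 < m → coeff p m ≈ 0#) → ∀ n → coeff (p *ₚ q) n ≈ coeff p 0 * coeff q n
  *ₚ-tail≈0 {[]}    q z n = sym (zeroˡ _)
  *ₚ-tail≈0 {a ∷ p} q z n = begin
    coeff (a ·ₚ q +ₚ (0# ∷ p *ₚ q)) n       ≈⟨ coeff-+ (a ·ₚ q) (0# ∷ p *ₚ q) n ⟩
    coeff (a ·ₚ q) n + coeff (0# ∷ p *ₚ q) n ≈⟨ +-cong (coeff-· a q n) (coeff≈ pq≈0 n) ⟩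
    a * coeff q n + 0#                      ≈⟨ +-identityʳ _ ⟩
    a * coeff q n                           ∎
    where
    pq≈0 : 0# ∷ p *ₚ q ≈ₚ []
    pq≈0 = ≈ₚ-trans (∷-cong refl (*ₚ-cong {p} {[]} {q} {q} (mk≈ λ n → z (s≤s z≤n)) ≈ₚ-refl)) 0∷[]

  *ₚ-high {[]}    hp hq _ = refl
  *ₚ-high {a ∷ p} {q} {zero} {j} hp hq {m} j<m =
    trans (*ₚ-tail≈0 {a ∷ p} q hp m) (trans (*-congˡ (hq j<m)) (zeroʳ a))
  *ₚ-high {a ∷ p} {q} {suc i} {j} hp hq {suc m} (s≤s i+j<m) = begin
    coeff (a ·ₚ q +ₚ (0# ∷ p *ₚ q)) (suc m)        ≈⟨ coeff-+ (a ·ₚ q) (0# ∷ p *ₚ q) (suc m) ⟩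
    coeff (a ·ₚ q) (suc m) + coeff (p *ₚ q) m      ≈⟨ +-cong (coeff-· a q (suc m)) (*ₚ-high {p} {q} {i} {j} (λ i<m → hp (s≤s i<m)) hq i+j<m) ⟩
    a * coeff q (suc m) + 0#                       ≈⟨ +-identityʳ _ ⟩
    a * coeff q (suc m)                            ≈⟨ *-congˡ (hq (ℕₚ.m<n⇒m<1+n (ℕₚ.≤-trans (s≤s (ℕₚ.m≤n+m j i)) i+j<m))) ⟩
    a * 0#                                         ≈⟨ zeroʳ a ⟩
    0#                                             ∎

  *ₚ-lead {[]}    hp hq = sym (zeroˡ _)
  *ₚ-lead {a ∷ p} {q} {zero} {j} hp hq = *ₚ-tail≈0 {a ∷ p} q hp j
  *ₚ-lead {a ∷ p} {q} {suc i} {j} hp hq = begin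
    coeff (a ·ₚ q +ₚ (0# ∷ p *ₚ q)) (suc (i ℕ.+ j))              ≈⟨ coeff-+ (a ·ₚ q) (0# ∷ p *ₚ q) (suc (i ℕ.+ j)) ⟩
    coeff (a ·ₚ q) (suc (i ℕ.+ j)) + coeff (p *ₚ q) (i ℕ.+ j)    ≈⟨ +-cong (coeff-· a q _) (*ₚ-lead {p} {q} {i} {j} (λ i<m → hp (s≤s i<m)) hq) ⟩
    a * coeff q (suc (i ℕ.+ j)) + coeff p i * coeff q j          ≈⟨ +-congʳ (*-congˡ (hq (s≤s (ℕₚ.m≤n+m j i)))) ⟩
    a * 0# + coeff p i * coeff q j                               ≈⟨ +-congʳ (zeroʳ a) ⟩
    0# + coeff p i * coeff q j                                   ≈⟨ +-identityˡ _ ⟩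
    coeff p i * coeff q j                                        ∎

-- A model of 𝔽_q: any field with q elements (unique up to isomorphism).
record FiniteField (c ℓ : Level) (q : ℕ) : Set (Level.suc (c ⊔ ℓ)) where
  field
    commutativeRing : CommutativeRing c ℓ
  open CommutativeRing commutativeRing public
  field
    0≉1     : 0# ≉ 1#
    inverse : ∀ x → x ≉ 0# → ∃ λ y → x * y ≈ 1#
    size    : HasSize setoid q

module _ {c ℓ q} (F : FiniteField c ℓ q) where
  open FiniteField F
  open Polynomials commutativeRing
  open RawSemiringDefs (Semiring.rawSemiring (CommutativeRing.semiring polyRing)) using (Coprime; _∣_)
  open RawMagmaDefs (Semiring.*-rawMagma (CommutativeRing.semiring polyRing)) using (_,_)
  private module Size = Inverse size

  infix 4 _≟_
  _≟_ : Binary.Decidable _≈_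
  x ≟ y = map′
    (λ e → trans (sym (Size.inverseˡ ≡.refl)) (Size.inverseˡ e))
    Size.from-cong
    (Size.from x Finₚ.≟ Size.from y)

  decSetoid : DecSetoid c ℓ
  decSetoid = record { isDecEquivalence = record { isEquivalence = isEquivalence ; _≟_ = _≟_ } }

  -- 𝒫¹(𝔽_q), with nothing as ∞.
  ℙ¹ : DecSetoid c (c ⊔ ℓ)
  ℙ¹ = Maybe.decSetoid decSetoid

  private module ℙ¹ = DecSetoid ℙ¹

  -- x ÷ 0 is ∞ for every x; numerator and denominator of a reduced fraction
  -- never vanish together.
  infixl 7 _÷_
  _÷_ : Carrier → Carrier → ℙ¹.Carrier
  x ÷ y with y ≟ 0#
  ... | yes _   = nothing
  ... | no  y≉0 = just (x * proj₁ (inverse y y≉0))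

  -- v and u stand for the degrees of V and U, so that coeff V v and coeff U u
  -- are the leading coefficients.
  value : (V U : Poly) (v u : ℕ) → ℙ¹.Carrier → ℙ¹.Carrier
  value V U v u (just a) = eval V a ÷ eval U a
  value V U v u nothing with ℕₚ.<-cmp v u
  ... | tri< _ _ _ = just 0#
  ... | tri≈ _ _ _ = coeff V v ÷ coeff U u
  ... | tri> _ _ _ = nothing

  -- Coprime says that every common divisor divides 1, i.e. gcd(V , U) = 1.
  record IsFraction (v u : ℕ) (V U : Poly) : Set (c ⊔ ℓ) where
    field
      num-degree : HasDegree V v
      den-degree : HasDegree U u
      coprime    : Coprime V U

  record Fraction (v u : ℕ) : Set (c ⊔ ℓ) where
    field
      num den    : Poly
      isFraction : IsFraction v u num den
    open IsFraction isFraction public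

    evaluate : ℙ¹.Carrier → ℙ¹.Carrier
    evaluate = value num den v u

  open Fraction

  IsPRF : ∀ {v u} → Fraction v u → Set (c ⊔ ℓ)
  IsPRF f = Bijective ℙ¹._≈_ ℙ¹._≈_ (evaluate f)

  ÷-cong : ∀ {x x′ y y′} → x ≈ x′ → y ≈ y′ → x ÷ y ℙ¹.≈ x′ ÷ y′
  ÷-cong {x} {x′} {y} {y′} e e′ with y ≟ 0# | y′ ≟ 0#
  ... | yes _   | yes _   = Maybe.nothing
  ... | yes y≈0 | no y′≉0 = ⊥-elim (y′≉0 (trans (sym e′) y≈0))
  ... | no y≉0  | yes y′≈0 = ⊥-elim (y≉0 (trans e′ y′≈0))
  ... | no y≉0  | no y′≉0 = Maybe.just (*-cong e (begin
    i              ≈⟨ *-identityʳ i ⟨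
    i * 1#         ≈⟨ *-congˡ (proj₂ (inverse y′ y′≉0)) ⟨
    i * (y′ * i′)  ≈⟨ *-assoc i y′ i′ ⟨
    i * y′ * i′    ≈⟨ *-congʳ (trans (*-comm i y′) (*-congʳ (sym e′))) ⟩
    y * i * i′     ≈⟨ *-congʳ (proj₂ (inverse y y≉0)) ⟩
    1# * i′        ≈⟨ *-identityˡ i′ ⟩
    i′             ∎))
    where
    open SetoidReasoning setoid
    i  = proj₁ (inverse y y≉0)
    i′ = proj₁ (inverse y′ y′≉0)

  value-cong : ∀ {V V′ U U′} v u {x y} → V ≈ₚ V′ → U ≈ₚ U′ → x ℙ¹.≈ y →
               value V U v u x ℙ¹.≈ value V′ U′ v u y
  value-cong {V} {V′} {U} {U′} v u V≈ U≈ (Maybe.just e) =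
    ÷-cong (eval-cong {V} {V′} V≈ e) (eval-cong {U} {U′} U≈ e)
  value-cong v u V≈ U≈ Maybe.nothing with ℕₚ.<-cmp v u
  ... | tri< _ _ _ = Maybe.just refl
  ... | tri≈ _ _ _ = ÷-cong (coeff≈ V≈ v) (coeff≈ U≈ u)
  ... | tri> _ _ _ = Maybe.nothing

  noZeroDivisors : ∀ {x y} → x ≉ 0# → y ≉ 0# → x * y ≉ 0#
  noZeroDivisors {x} {y} x≉0 y≉0 xy≈0 = x≉0 (begin
    x             ≈⟨ *-identityʳ x ⟨
    x * 1#        ≈⟨ *-congˡ (proj₂ (inverse y y≉0)) ⟨
    x * (y * y⁻¹) ≈⟨ *-assoc x y y⁻¹ ⟨
    x * y * y⁻¹   ≈⟨ *-congʳ xy≈0 ⟩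
    0# * y⁻¹      ≈⟨ zeroˡ y⁻¹ ⟩
    0#            ∎)
    where
    open SetoidReasoning setoid
    y⁻¹ = proj₁ (inverse y y≉0)

  degree? : ∀ p → p ≈ₚ [] ⊎ ∃ (HasDegree p)
  degree? [] = inj₁ ≈ₚ-refl
  degree? (a ∷ p) with degree? p
  ... | inj₂ (n , mkDegree lead high) = inj₂ (suc n , mkDegree lead λ { {suc m} (s≤s n<m) → high n<m })
  ... | inj₁ p≈0 with a ≟ 0#
  ...   | yes a≈0 = inj₁ (≈ₚ-trans (∷-cong a≈0 p≈0) 0∷[])
  ...   | no  a≉0 = inj₂ (0 , mkDegree a≉0 λ { {suc m} _ → coeff≈ p≈0 m })

  *ₚ-hasDegree : ∀ {p q i j} → HasDegree p i → HasDegree q j → HasDegree (p *ₚ q) (i ℕ.+ j)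
  *ₚ-hasDegree {p} {q} {i} {j} (mkDegree leadₚ highₚ) (mkDegree leadq highq) = mkDegree
      (λ z → noZeroDivisors leadₚ leadq (trans (sym (*ₚ-lead {p} {q} {i} {j} highₚ highq)) z))
      (*ₚ-high {p} {q} {i} {j} highₚ highq)

  hasDegree⇒≉0 : ∀ {p n} → HasDegree p n → ¬ p ≈ₚ []
  hasDegree⇒≉0 d e = leading≉0 d (coeff≈ e _)

  hasDegree-unique : ∀ {p m n} → HasDegree p m → HasDegree p n → m ≡ n
  hasDegree-unique {m = m} {n} (mkDegree leadₘ highₘ) (mkDegree leadₙ highₙ) with ℕₚ.<-cmp m n
  ... | tri< m<n _ _ = ⊥-elim (leadₙ (highₘ m<n))
  ... | tri≈ _ m≡n _ = m≡n
  ... | tri> _ _ n<m = ⊥-elim (leadₘ (highₙ n<m))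

  *ₚ-cancel-zero : ∀ {p q n} → HasDegree q n → p *ₚ q ≈ₚ [] → p ≈ₚ []
  *ₚ-cancel-zero {p} {q} dq e with degree? p
  ... | inj₁ p≈0      = p≈0
  ... | inj₂ (m , dp) = ⊥-elim (hasDegree⇒≉0 (*ₚ-hasDegree {p} {q} dp dq) e)

  elements : List Carrier
  elements = map Size.to (allFin q)

  elements-complete : IsEnumeration setoid elements
  elements-complete x = Anyₚ.map⁺
    (Any.map (λ e → sym (Size.inverseˡ (≡.sym e))) (∈-allFin (Size.from x)))

  ℙ¹-elements : List ℙ¹.Carrier
  ℙ¹-elements = nothing ∷ map just elements

  ℙ¹-complete : IsEnumeration ℙ¹.setoid ℙ¹-elements
  ℙ¹-complete nothing  = here Maybe.nothing
  ℙ¹-complete (just x) = there (Anyₚ.map⁺ (Any.map Maybe.just (elements-complete x)))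

  polys : ℕ → List Poly
  polys zero    = [] ∷ []
  polys (suc n) = cartesianProductWith _∷_ elements (polys n)

  polys-complete : ∀ n p → (∀ {m} → n ≤ m → coeff p m ≈ 0#) → Any (p ≈ₚ_) (polys n)
  polys-complete zero    p z = here (mk≈ λ n → z z≤n)
  polys-complete (suc n) [] z = Anyₚ.cartesianProductWith⁺ _∷_
    (λ e e′ → ≈ₚ-trans (≈ₚ-sym 0∷[]) (∷-cong e e′)) (elements-complete 0#) (polys-complete n [] λ _ → refl)
  polys-complete (suc n) (a ∷ p) z = Anyₚ.cartesianProductWith⁺ _∷_
    ∷-cong (elements-complete a) (polys-complete n p (λ n≤m → z (s≤s n≤m)))

  ≈[]? : ∀ p → Dec (p ≈ₚ [])
  ≈[]? p with degree? p
  ... | inj₁ p≈0     = yes p≈0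
  ... | inj₂ (_ , d) = no (hasDegree⇒≉0 d)

  _≟ₚ_ : Binary.Decidable _≈ₚ_
  []      ≟ₚ q       = map′ ≈ₚ-sym ≈ₚ-sym (≈[]? q)
  (a ∷ p) ≟ₚ []      = ≈[]? (a ∷ p)
  (a ∷ p) ≟ₚ (b ∷ q) = map′
    (λ (e , e′) → ∷-cong e e′)
    (λ e → coeff≈ e 0 , mk≈ λ n → coeff≈ e (suc n))
    ((a ≟ b) ×-dec (p ≟ₚ q))

  hasDegree? : ∀ p n → Dec (HasDegree p n)
  hasDegree? p n with degree? p
  ... | inj₁ p≈0     = no λ d → hasDegree⇒≉0 d p≈0
  ... | inj₂ (m , d) = map′ (λ { ≡.refl → d }) (hasDegree-unique d) (m ℕₚ.≟ n)

  factor-high : ∀ {p z w n} → HasDegree p n → w *ₚ z ≈ₚ p → ∀ {m} → n < m → coeff w m ≈ 0#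
  factor-high {p} {z} {w} {n} d e {m} n<m with degree? w | degree? z
  ... | inj₁ w≈0 | _ = coeff≈ w≈0 m
  ... | inj₂ _   | inj₁ z≈0 = ⊥-elim (hasDegree⇒≉0 d
    (≈ₚ-trans (≈ₚ-sym e) (≈ₚ-trans (*ₚ-congˡ w z≈0) (*ₚ-zeroʳ w))))
  ... | inj₂ (i , dw) | inj₂ (j , dz) = above≈0 dw (ℕₚ.≤-<-trans i≤n n<m)
    where
    i≤n : i ≤ n
    i≤n = ≡.subst (i ≤_) (hasDegree-unique (hasDegree-cong e (*ₚ-hasDegree {w} {z} dw dz)) d) (ℕₚ.m≤m+n i j)

  ∣-resp : ∀ {z z′ p p′} → z ≈ₚ z′ → p ≈ₚ p′ → z ∣ p → z′ ∣ p′
  ∣-resp {z} {z′} z≈ p≈ (w , e) = w , ≈ₚ-trans (*ₚ-congˡ w (≈ₚ-sym z≈)) (≈ₚ-trans e p≈)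

  divides? : ∀ z {p n} → HasDegree p n → Dec (z ∣ p)
  divides? z {p} {n} d = map′
    (λ a → let w , e = Any.satisfied a in w , e)
    (λ (w , e) → Any.map
      (λ {w′} w≈ → ≈ₚ-trans (*ₚ-cong {w′} {w} {z} {z} (≈ₚ-sym w≈) ≈ₚ-refl) e)
      (polys-complete (suc n) w (factor-high {z = z} {w} d e)))
    (any? (λ w → (w *ₚ z) ≟ₚ p) (polys (suc n)))

  coprime? : ∀ {p q m n} → HasDegree p m → HasDegree q n → Dec (Coprime p q)
  coprime? {p} {q} {m} dp dq = map′
    (λ as {z} z∣p z∣q → let z′ , _ , z≈ , h = nearby z z∣p as in
      ∣-resp (≈ₚ-sym z≈) ≈ₚ-refl (h (∣-resp z≈ ≈ₚ-refl z∣p) (∣-resp z≈ ≈ₚ-refl z∣q)))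
    (λ cop → All.tabulate λ _ → cop)
    (all? (λ z → divides? z dp →-dec divides? z dq →-dec divides? z {1ₚ} {0} d1) (polys (suc m)))
    where
    d1 : HasDegree 1ₚ 0
    d1 = mkDegree (0≉1 ∘ sym) λ { {suc _} _ → refl }
    nearby : ∀ z → z ∣ p → ∀ {ℓ′} {P : Poly → Set ℓ′} → All P (polys (suc m)) →
             ∃ λ z′ → z′ ∈ polys (suc m) × z ≈ₚ z′ × P z′
    nearby z (w , e) as =
      let z′ , z′∈ , z≈ = find (polys-complete (suc m) z (factor-high {z = w} {z} dp (≈ₚ-trans (*ₚ-comm z w) e)))
      in z′ , z′∈ , z≈ , All.lookup as z′∈

  -- Equality in 𝔽_q(x), by cross-multiplication; in particular V / U and
  -- (c V) / (c U) are identified.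
  infix 4 _≈ᶠ_
  _≈ᶠ_ : ∀ {v u v′ u′} → Fraction v u → Fraction v′ u′ → Set ℓ
  f ≈ᶠ g = num f *ₚ den g ≈ₚ num g *ₚ den f

  ≈ᶠ-trans : ∀ {v₁ u₁ v₂ u₂ v₃ u₃} (f : Fraction v₁ u₁) (g : Fraction v₂ u₂) (h : Fraction v₃ u₃) →
             f ≈ᶠ g → g ≈ᶠ h → f ≈ᶠ h
  ≈ᶠ-trans f g h f≈g g≈h = x∙y⁻¹≈ε⇒x≈y _ _ (*ₚ-cancel-zero {q = den g} (den-degree g) (begin
    (V *ₚ B +ₚ -ₚ (A *ₚ U)) *ₚ S          ≈⟨ *ₚ-distribʳ S (V *ₚ B) (-ₚ (A *ₚ U)) ⟩
    V *ₚ B *ₚ S +ₚ (-ₚ (A *ₚ U)) *ₚ S     ≈⟨ +ₚ-cong left (≈ₚ-trans (≈ₚ-sym (-‿distribˡ-* (A *ₚ U) S)) (-ₚ-cong right)) ⟩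
    R *ₚ U *ₚ B +ₚ -ₚ (R *ₚ U *ₚ B)       ≈⟨ ≈ₚ-trans (+ₚ-comm (R *ₚ U *ₚ B) (-ₚ (R *ₚ U *ₚ B))) (-ₚ-inverseˡ (R *ₚ U *ₚ B)) ⟩
    []                                    ∎))
    where
    open ≈ₚ-Reasoning
    open import Algebra.Properties.Ring (CommutativeRing.ring polyRing) using (-‿distribˡ-*; x∙y⁻¹≈ε⇒x≈y)
    open import Algebra.Properties.CommutativeSemigroup (CommutativeRing.*-commutativeSemigroup polyRing)
      using (xy∙z≈xz∙y)
    V = num f ; U = den f ; R = num g ; S = den g ; A = num h ; B = den h
    left : V *ₚ B *ₚ S ≈ₚ R *ₚ U *ₚ B
    left = ≈ₚ-trans (xy∙z≈xz∙y V B S) (*ₚ-cong f≈g (≈ₚ-refl {B}))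
    right : A *ₚ U *ₚ S ≈ₚ R *ₚ U *ₚ B
    right = ≈ₚ-trans (xy∙z≈xz∙y A U S) (≈ₚ-trans (*ₚ-cong (≈ₚ-sym g≈h) (≈ₚ-refl {U})) (xy∙z≈xz∙y R B U))

  P : ℕ → ℕ → DecSetoid (c ⊔ ℓ) ℓ
  P v u = record
    { Carrier = ∃ λ (f : Fraction v u) → IsPRF f
    ; _≈_     = λ f g → proj₁ f ≈ᶠ proj₁ g
    ; isDecEquivalence = record
      { isEquivalence = record
        { refl  = ≈ₚ-refl
        ; sym   = ≈ₚ-sym
        ; trans = λ {f} {g} {h} → ≈ᶠ-trans (proj₁ f) (proj₁ g) (proj₁ h)
        }
      ; _≟_ = λ f g → (_ ≟ₚ _)
      }
    }

  isPRF? : ∀ {v u} (f : Fraction v u) → Dec (IsPRF f)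
  isPRF? {v} {u} f = bijective? ℙ¹ ℙ¹-complete
    (value-cong {num f} {num f} {den f} {den f} v u ≈ₚ-refl ≈ₚ-refl)

  module _ (v u : ℕ) where

    isFraction? : (VU : Poly × Poly) → Dec (IsFraction v u (proj₁ VU) (proj₂ VU))
    isFraction? (V , U) with hasDegree? V v | hasDegree? U u
    ... | no ¬dV | _      = no λ f → ¬dV (IsFraction.num-degree f)
    ... | yes _  | no ¬dU = no λ f → ¬dU (IsFraction.den-degree f)
    ... | yes dV | yes dU = map′ {A = Coprime V U}
      (λ cop → record { num-degree = dV ; den-degree = dU ; coprime = cop })
      (λ f → IsFraction.coprime f) (coprime? dV dU)

    isFraction-cong : ∀ {V V′ U U′} → V ≈ₚ V′ → U ≈ₚ U′ → IsFraction v u V U → IsFraction v u V′ U′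
    isFraction-cong V≈ U≈ f = record
      { num-degree = hasDegree-cong V≈ (IsFraction.num-degree f)
      ; den-degree = hasDegree-cong U≈ (IsFraction.den-degree f)
      ; coprime    = λ z∣V z∣U → IsFraction.coprime f
          (∣-resp ≈ₚ-refl (≈ₚ-sym V≈) z∣V) (∣-resp ≈ₚ-refl (≈ₚ-sym U≈) z∣U)
      }

    toFraction : ∃ (λ (VU : Poly × Poly) → IsFraction v u (proj₁ VU) (proj₂ VU)) → Fraction v u
    toFraction ((V , U) , f) = record { num = V ; den = U ; isFraction = f }

    candidates : List (Poly × Poly)
    candidates = cartesianProduct (polys (suc v)) (polys (suc u))

    fractions : List (Fraction v u)
    fractions = map toFraction (collect isFraction? candidates)

    PRFs : List (∃ λ (f : Fraction v u) → IsPRF f)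
    PRFs = collect isPRF? fractions

    fractions-complete : ∀ (f : Fraction v u) →
      ∃ λ g → g ∈ fractions × num f ≈ₚ num g × den f ≈ₚ den g
    fractions-complete f =
      let V , V∈ , V≈ = find (polys-complete (suc v) (num f) (above≈0 (num-degree f)))
          U , U∈ , U≈ = find (polys-complete (suc u) (den f) (above≈0 (den-degree f)))
          g , g∈ , g≡ = find (collect-complete isFraction? (∈-cartesianProduct⁺ V∈ U∈)
            (isFraction-cong V≈ U≈ (isFraction f)))
      in toFraction g , Anyₚ.map⁺ (Any.map (≡.cong toFraction) g∈)
       , ≈ₚ-trans V≈ (≡.subst (V ≈ₚ_) (≡.cong proj₁ (≡.sym g≡)) ≈ₚ-refl)
       , ≈ₚ-trans U≈ (≡.subst (U ≈ₚ_) (≡.cong proj₂ (≡.sym g≡)) ≈ₚ-refl)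

    IsPRF-resp : ∀ {f g : Fraction v u} → num f ≈ₚ num g → den f ≈ₚ den g → IsPRF f → IsPRF g
    IsPRF-resp {f} {g} n≈ d≈ (inj , sur) =
        (λ {x} {y} e → inj {x} {y} (ℙ¹.trans (same x) (ℙ¹.trans e (ℙ¹.sym (same y)))))
      , λ y → proj₁ (sur y) , λ {z} e → ℙ¹.trans (ℙ¹.sym (same z)) (proj₂ (sur y) e)
      where
      same : ∀ x → evaluate f x ℙ¹.≈ evaluate g x
      same x = value-cong {num f} {num g} {den f} {den g} v u n≈ d≈ (ℙ¹.refl {x})

    PRFs-complete : IsEnumeration (DecSetoid.setoid (P v u)) PRFs
    PRFs-complete (f , f-prf) =
      let g , g∈ , n≈ , d≈ = fractions-complete f in
      Any.map (λ { ≡.refl → *ₚ-cong n≈ (≈ₚ-sym d≈) })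
        (collect-complete isPRF? g∈ (IsPRF-resp {f} {g} n≈ d≈ f-prf))

    -- N v u is the number of elements of P v u as a setoid.
    N-exists : ∃ (HasSize (DecSetoid.setoid (P v u)))
    N-exists = size-exists (P v u) PRFs-complete

    N : ℕ
    N = proj₁ N-exists

  -- The sum over 0 ≤ v, u ≤ (d + 1) / 2; upTo k is 0, …, k - 1.
  𝒯 : ℕ → ℕ
  𝒯 d = sum (map (λ v → sum (map (N v) range)) range)
    where
    range = upTo (suc ((d ℕ.+ 1) / 2))

IsPrimePower : ℕ → Set
IsPrimePower q = ∃₂ λ p k → Prime p × 1 ≤ k × q ≡ p ℕ.^ k

{-# OPTIONS --safe #-}

-- If V/U and V′/U′ have degrees at most k = (d + 1) / 2, their agreements on
-- 𝒫¹(𝔽_q) are zeros of Δ = V U′ − V′ U, read as a binary form of degree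
-- 2k ≤ d + 1: agreement at ∞ makes the coefficient of degree 2k vanish.
-- Unless Δ = 0 there are at most d + 1 of them, so the two permutations of the
-- q + 1 points are at distance at least q − d.  If Δ = 0, then coprimality
-- forces the degrees to be equal, so no rational function is counted under two
-- different pairs (v, u).
module Submission where

open import Algebra.Bundles using (CommutativeRing; CommutativeSemiring; Semiring)
import Algebra.Definitions.RawMagma as RawMagmaDefs
import Algebra.Definitions.RawSemiring as RawSemiringDefs
import Algebra.Properties.CommutativeSemigroup as CommutativeSemigroupProperties
import Algebra.Properties.Monoid.Divisibility as DivisibilityProperties
import Algebra.Properties.Ring as RingProperties
import Algebra.Solver.Ring.NaturalCoefficients.Default as SemiringSolver
open import Data.Empty using (⊥-elim)
open import Data.Fin.Base using (Fin; zero; suc; splitAt; join; punchOut; _↑ˡ_; _↑ʳ_)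
open import Data.Fin.Permutation as Perm using (Permutation′; _⟨$⟩ʳ_)
import Data.Fin.Properties as Finₚ
open import Data.List.Base using ([]; _∷_; length; map; filter; allFin; lookup; upTo)
open import Data.List.Membership.Propositional.Properties using (∈-lookup; ∈-upTo⁻)
open import Data.List.Properties using (length-map; length-tabulate; filter-none)
open import Data.List.Relation.Unary.All as All using (All; []; _∷_)
import Data.List.Relation.Unary.All.Properties as Allₚ
open import Data.List.Relation.Unary.AllPairs using ([]; _∷_)
open import Data.List.Relation.Unary.Unique.Setoid using (Unique)
import Data.List.Relation.Unary.Unique.Propositional.Properties as Uniqueₚ
import Data.List.Relation.Unary.Unique.Setoid.Properties as UniqueSetoidₚ
open import Data.Maybe.Base using (Maybe; just; nothing)
import Data.Maybe.Relation.Binary.Pointwise as Maybe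
open import Data.Nat.Base as ℕ using (ℕ; zero; suc; _≤_; _<_; z≤n; s≤s)
open import Data.Nat.DivMod using (_/_; m/n*n≤m)
open import Data.Nat.ListAction using (sum)
import Data.Nat.Properties as ℕₚ
open import Data.Product.Base using (Σ; ∃; ∃₂; _×_; _,_; proj₁; proj₂)
open import Data.Sum.Base using (inj₁; inj₂)
open import Defs
open import Function.Base using (_∘_)
open import Function.Bundles using (Inverse; mk⤖)
open import Function.Definitions using (Injective)
open import Function.Properties.Bijection using (⤖⇒↔)
open import Relation.Binary.Bundles using (Setoid; DecSetoid)
open import Relation.Binary.Definitions using (tri<; tri≈; tri>)
open import Relation.Binary.PropositionalEquality as ≡ using (_≡_)
import Relation.Binary.Reasoning.Setoid as SetoidReasoning
open import Relation.Nullary using (¬_; yes; no; ¬?)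
open import Relation.Unary using (Pred; Decidable)

-- Counting in lists, sums and finite setoids.

module _ {a p} {A : Set a} {P : Pred A p} (P? : Decidable P) where

  length-filter-complement : ∀ xs →
    length (filter (¬? ∘ P?) xs) ℕ.+ length (filter P? xs) ≡ length xs
  length-filter-complement [] = ≡.refl
  length-filter-complement (x ∷ xs) with P? x
  ... | yes _ = ≡.trans (ℕₚ.+-suc _ _) (≡.cong suc (length-filter-complement xs))
  ... | no  _ = ≡.cong suc (length-filter-complement xs)

module _ {a} {A : Set a} (N : A → ℕ) where

  unsum : ∀ xs → Fin (sum (map N xs)) → Σ (Fin (length xs)) λ j → Fin (N (lookup xs j))
  unsum (x ∷ xs) k with splitAt (N x) k
  ... | inj₁ i = zero , i
  ... | inj₂ l = suc (proj₁ (unsum xs l)) , proj₂ (unsum xs l)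

  resum : ∀ xs → (Σ (Fin (length xs)) λ j → Fin (N (lookup xs j))) → Fin (sum (map N xs))
  resum (x ∷ xs) (zero  , i) = i ↑ˡ sum (map N xs)
  resum (x ∷ xs) (suc j , i) = N x ↑ʳ resum xs (j , i)

  -- A left inverse makes `unsum` injective; applied at both levels of the double sum, it keeps the
  -- codewords distinct.
  resum-unsum : ∀ xs k → resum xs (unsum xs k) ≡ k
  resum-unsum (x ∷ xs) k with splitAt (N x) k in eq
  ... | inj₁ i = ≡.trans (≡.cong (join (N x) _) (≡.sym eq)) (Finₚ.join-splitAt (N x) _ k)
  ... | inj₂ l = ≡.trans (≡.cong (N x ↑ʳ_) (resum-unsum xs l))
    (≡.trans (≡.cong (join (N x) _) (≡.sym eq)) (Finₚ.join-splitAt (N x) _ k))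

-- Pigeonhole: if `y` is missed, punching it out of the codomain leaves an injection from
-- `Fin (suc n)` into `Fin n`.
injective⇒surjective : ∀ {n} {f : Fin n → Fin n} → Injective _≡_ _≡_ f → ∀ y → ∃ λ x → f x ≡ y
injective⇒surjective {suc n} {f} inj y with Finₚ.any? (λ x → f x Finₚ.≟ y)
... | yes hit = hit
... | no miss = ⊥-elim (Finₚ.<⇒notInjective {f = λ x → punchOut (y≢f x)} ℕₚ.≤-refl
                  λ {x} {x′} e → inj (Finₚ.punchOut-injective (y≢f x) (y≢f x′) e))
  where
  y≢f : ∀ x → ¬ y ≡ f x
  y≢f x e = miss (x , ≡.sym e)

module _ {a ℓ} {S : Setoid a ℓ} where
  open Setoid S

  module _ {n} (size : HasSize S n) where
    open Inverse size

    to-injective : ∀ {i j} → to i ≈ to j → i ≡ j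
    to-injective e = ≡.trans (≡.sym (inverseʳ refl)) (≡.trans (from-cong e) (inverseʳ refl))

    from-injective : ∀ {x y} → from x ≡ from y → x ≈ y
    from-injective e = trans (sym (inverseˡ ≡.refl)) (inverseˡ e)

    -- The result acts definitionally as `from ∘ f ∘ to`, so agreements of two such permutations
    -- become agreements of the underlying maps by `from-injective`.
    injection⇒permutation : ∀ {f} → Injective _≈_ _≈_ f → Permutation′ n
    injection⇒permutation {f} inj = ⤖⇒↔ (mk⤖ {to = from ∘ f ∘ to}
      (g-injective , λ y → proj₁ (injective⇒surjective g-injective y)
                         , λ { ≡.refl → proj₂ (injective⇒surjective g-injective y) }))
      where
      g-injective : Injective _≡_ _≡_ (from ∘ f ∘ to)
      g-injective e = to-injective (inj (from-injective e))

  maybe-size : ∀ {n} → HasSize S n → HasSize (Maybe.setoid S) (suc n)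
  maybe-size {n} size = record
    { to        = to′
    ; from      = from′
    ; to-cong   = λ { ≡.refl → Setoid.refl (Maybe.setoid S) }
    ; from-cong = λ { (Maybe.just e) → ≡.cong suc (from-cong e) ; Maybe.nothing → ≡.refl }
    ; inverse   = (λ { {nothing} ≡.refl → Maybe.nothing ; {just x} ≡.refl → Maybe.just (inverseˡ ≡.refl) })
                , λ { {zero} Maybe.nothing → ≡.refl ; {suc i} (Maybe.just e) → ≡.cong suc (inverseʳ e) }
    }
    where
    open Inverse size
    to′ : Fin (suc n) → Maybe Carrier
    to′ zero    = nothing
    to′ (suc i) = just (to i)
    from′ : Maybe Carrier → Fin (suc n)
    from′ nothing  = zero
    from′ (just x) = suc (from x)

-- Commutative semiring identities.

module _ {c ℓ} (R : CommutativeSemiring c ℓ) where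
  open CommutativeSemiring R 
  open SemiringSolver R using (solve; _:+_; _:*_; _:=_)

  factor-step : ∀ a x r y z w →
    (a + x * y) + r * (z + x * w) ≈ (a + r * z) + x * (y + r * w)
  factor-step = solve 6 (λ a x r y z w →
    (a :+ x :* y) :+ r :* (z :+ x :* w) := (a :+ r :* z) :+ x :* (y :+ r :* w)) refl

  euclid-step : ∀ a b t p q → a * q + b * (p + t * q) ≈ b * p + (a + b * t) * q
  euclid-step = solve 5 (λ a b t p q →
    a :* q :+ b :* (p :+ t :* q) := b :* p :+ (a :+ b :* t) :* q) refl

  bezout-step : ∀ a b p q s → (a * p + b * q) * s ≈ a * (p * s) + (b * s) * q
  bezout-step = solve 5 (λ a b p q s →
    (a :* p :+ b :* q) :* s := a :* (p :* s) :+ (b :* s) :* q) refl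

-- Evaluation of polynomials and division by a linear factor.

module _ {c ℓ} (R : CommutativeRing c ℓ) where
  open CommutativeRing R
  open Polynomials R
  open RingProperties ring using (-0#≈0#; -‿+-comm; -‿distribʳ-*)
  open CommutativeSemigroupProperties +-commutativeSemigroup using (interchange)
  open CommutativeSemigroupProperties *-commutativeSemigroup using (x∙yz≈y∙xz)
  open SetoidReasoning setoid

  eval-+ : ∀ p q x → eval (p +ₚ q) x ≈ eval p x + eval q x
  eval-+ []      q       x = sym (+-identityˡ _)
  eval-+ (a ∷ p) []      x = sym (+-identityʳ _)
  eval-+ (a ∷ p) (b ∷ q) x = begin
    a + b + x * eval (p +ₚ q) x             ≈⟨ +-congˡ (*-congˡ (eval-+ p q x)) ⟩
    a + b + x * (eval p x + eval q x)       ≈⟨ +-congˡ (distribˡ _ _ _) ⟩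
    a + b + (x * eval p x + x * eval q x)   ≈⟨ interchange _ _ _ _ ⟩
    a + x * eval p x + (b + x * eval q x)   ∎

  eval-neg : ∀ p x → eval (-ₚ p) x ≈ - eval p x
  eval-neg []      x = sym -0#≈0#
  eval-neg (a ∷ p) x = begin
    - a + x * eval (-ₚ p) x   ≈⟨ +-congˡ (*-congˡ (eval-neg p x)) ⟩
    - a + x * - eval p x      ≈⟨ +-congˡ (-‿distribʳ-* _ _) ⟨
    - a + - (x * eval p x)    ≈⟨ -‿+-comm _ _ ⟩
    - (a + x * eval p x)      ∎

  eval-· : ∀ a p x → eval (a ·ₚ p) x ≈ a * eval p x
  eval-· a []      x = sym (zeroʳ a)
  eval-· a (b ∷ p) x = begin
    a * b + x * eval (a ·ₚ p) x   ≈⟨ +-congˡ (*-congˡ (eval-· a p x)) ⟩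
    a * b + x * (a * eval p x)    ≈⟨ +-congˡ (x∙yz≈y∙xz x a _) ⟩
    a * b + a * (x * eval p x)    ≈⟨ distribˡ a _ _ ⟨
    a * (b + x * eval p x)        ∎

  eval-* : ∀ p q x → eval (p *ₚ q) x ≈ eval p x * eval q x
  eval-* []      q x = sym (zeroˡ _)
  eval-* (a ∷ p) q x = begin
    eval (a ·ₚ q +ₚ (0# ∷ p *ₚ q)) x                  ≈⟨ eval-+ (a ·ₚ q) (0# ∷ p *ₚ q) x ⟩
    eval (a ·ₚ q) x + (0# + x * eval (p *ₚ q) x)      ≈⟨ +-cong (eval-· a q x) (+-identityˡ _) ⟩
    a * eval q x + x * eval (p *ₚ q) x                ≈⟨ +-congˡ (*-congˡ (eval-* p q x)) ⟩
    a * eval q x + x * (eval p x * eval q x)          ≈⟨ +-congˡ (*-assoc x _ _) ⟨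
    a * eval q x + x * eval p x * eval q x            ≈⟨ distribʳ _ _ _ ⟨
    (a + x * eval p x) * eval q x                     ∎

  -- The quotient of p by the linear polynomial with root r.
  quot : Poly → Carrier → Poly
  quot []      r = []
  quot (_ ∷ p) r = eval p r ∷ quot p r

  -- p(x) − p(r) = (x − r) · quot p r (x), with the negative terms moved across.
  eval-quot : ∀ p r x → eval p x + r * eval (quot p r) x ≈ eval p r + x * eval (quot p r) x
  eval-quot []      r x = trans (+-congˡ (zeroʳ r)) (+-congˡ (sym (zeroʳ x)))
  eval-quot (a ∷ p) r x = begin
    a + x * eval p x + r * (eval p r + x * eval (quot p r) x)
      ≈⟨ factor-step commutativeSemiring a x r _ _ _ ⟩
    a + r * eval p r + x * (eval p x + r * eval (quot p r) x)
      ≈⟨ +-congˡ (*-congˡ (eval-quot p r x)) ⟩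
    a + r * eval p r + x * (eval p r + x * eval (quot p r) x)  ∎

  -- A bound rather than an exact degree, so that it also covers the zero polynomial and differences
  -- whose leading terms cancel.
  DegreeBelow : Poly → ℕ → Set ℓ
  DegreeBelow p n = ∀ {m} → n ≤ m → coeff p m ≈ 0#

  degreeBelow-0 : ∀ {p} → DegreeBelow p 0 → p ≈ₚ []
  degreeBelow-0 d = mk≈ λ n → d z≤n

  eval≈0 : ∀ {p} → p ≈ₚ [] → ∀ x → eval p x ≈ 0#
  eval≈0 {p} e x = eval-cong {p} {[]} {x} {x} e refl

  -- Coefficient `m` of the quotient is the value at `r` of `p` with its first m + 1 coefficients
  -- removed. The condition `n ≤ suc m` lowers the degree bound by one without subtraction in ℕ.
  quot-degreeBelow : ∀ p r {n} → DegreeBelow p n → ∀ {m} → n ≤ suc m → coeff (quot p r) m ≈ 0#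
  quot-degreeBelow []      r d _ = refl
  quot-degreeBelow (a ∷ p) r {n} d {zero} n≤1 =
    eval≈0 {p} (degreeBelow-0 {p} λ _ → d (ℕₚ.≤-trans n≤1 (s≤s z≤n))) r
  quot-degreeBelow (a ∷ p) r {n} d {suc m} n≤2+m =
    quot-degreeBelow p r {suc m} (λ m<k → d (ℕₚ.≤-trans n≤2+m (s≤s m<k))) ℕₚ.≤-refl

  -- The head of the quotient is the value at `r` of the tail of `p`, so the hypotheses pass to the
  -- tail; once the tail is zero, the root condition leaves only the constant term.
  quot≈0 : ∀ p r → eval p r ≈ 0# → quot p r ≈ₚ [] → p ≈ₚ []
  quot≈0 []      r _ _ = ≈ₚ-refl
  quot≈0 (a ∷ p) r z e = ≈ₚ-trans (∷-cong a≈0 p≈0) 0∷[]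
    where
    p≈0 : p ≈ₚ []
    p≈0 = quot≈0 p r (coeff≈ e 0) (mk≈ λ n → coeff≈ e (suc n))
    a≈0 : a ≈ 0#
    a≈0 = begin
      a                  ≈⟨ +-identityʳ a ⟨
      a + 0#             ≈⟨ +-congˡ (zeroʳ r) ⟨
      a + r * 0#         ≈⟨ +-congˡ (*-congˡ (eval≈0 p≈0 r)) ⟨
      a + r * eval p r   ≈⟨ z ⟩
      0#                 ∎

-- Zeros of binary forms on the projective line.

module _ {c ℓ q} (F : FiniteField c ℓ q) where
  open FiniteField F
  open Polynomials commutativeRing
  open RawSemiringDefs (Semiring.rawSemiring (CommutativeRing.semiring polyRing)) using (Coprime; _∣_)
  open RawMagmaDefs (Semiring.*-rawMagma (CommutativeRing.semiring polyRing)) using (_,_)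
  open RingProperties ring using ([y-z]x≈yx-zx)
  private
    module ℙ¹ = DecSetoid (ℙ¹ F)
    R = commutativeRing

  x*z≈y*z⇒z≈0 : ∀ {x y z} → ¬ x ≈ y → x * z ≈ y * z → z ≈ 0#
  x*z≈y*z⇒z≈0 {x} {y} {z} x≉y e with _≟_ F z 0#
  ... | yes z≈0 = z≈0
  ... | no  z≉0 = ⊥-elim (noZeroDivisors F
    (λ x-y≈0 → x≉y (RingProperties.x∙y⁻¹≈ε⇒x≈y ring x y x-y≈0)) z≉0
    (trans ([y-z]x≈yx-zx z x y) (RingProperties.x≈y⇒x∙y⁻¹≈ε ring e)))

  -- p is read as a binary form of degree n − 1, whose value at ∞ is its
  -- coefficient of degree n − 1.
  VanishesAt : Poly → ℕ → Maybe Carrier → Set ℓ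
  VanishesAt p n (just x) = eval p x ≈ 0#
  VanishesAt p n nothing  = ∀ {m} → n ≤ suc m → coeff p m ≈ 0#

  -- At a finite `x`, `eval-quot` reduces to r Q(x) = x Q(x), and r differs from x. At ∞ the lower
  -- degree of `p` passes to the quotient.
  vanishesAt-quot : ∀ {p n r z} → ¬ just r ℙ¹.≈ z → eval p r ≈ 0# → DegreeBelow R p (suc n) →
                    VanishesAt p (suc n) z → VanishesAt (quot R p r) n z
  vanishesAt-quot {p} {n} {r} {just x} r≉x pr≈0 d px≈0 =
    x*z≈y*z⇒z≈0 {r} {x} (λ e → r≉x (Maybe.just e)) (begin
      r * Q             ≈⟨ +-identityˡ _ ⟨
      0# + r * Q        ≈⟨ +-congʳ px≈0 ⟨
      eval p x + r * Q  ≈⟨ eval-quot R p r x ⟩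
      eval p r + x * Q  ≈⟨ +-congʳ pr≈0 ⟩
      0# + x * Q        ≈⟨ +-identityˡ _ ⟩
      x * Q             ∎)
    where
    open SetoidReasoning setoid
    Q = eval (quot R p r) x
  vanishesAt-quot {p} {n} {r} {nothing} _ _ d z = quot-degreeBelow R p r {n} λ { n≤m → z (s≤s n≤m) }

  -- Dividing a form by the linear factor that vanishes at ∞ keeps the dehomogenised polynomial,
  -- hence its values at finite points.
  vanishesAt-drop : ∀ {p n z} → ¬ nothing ℙ¹.≈ z → VanishesAt p (suc n) z → VanishesAt p n z
  vanishesAt-drop {z = just _}  _  v = v
  vanishesAt-drop {z = nothing} ∞≉ _ = ⊥-elim (∞≉ Maybe.nothing)

  -- Every zero lowers the degree of the form by one: a finite zero through `quot`, the zero at ∞ by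
  -- keeping `p` and lowering only the bound. After `n` zeros no coefficient is left.
  roots-bound : ∀ n p {zs} → DegreeBelow R p n → Unique ℙ¹.setoid zs →
                All (VanishesAt p n) zs → n ≤ length zs → p ≈ₚ []
  roots-bound zero    p d _ _ _ = degreeBelow-0 R {p} d
  roots-bound (suc n) p {just r ∷ zs} d (r∉ ∷ u) (v ∷ vs) (s≤s n≤) =
    quot≈0 R p r v (roots-bound n (quot R p r)
      (λ n≤m → quot-degreeBelow R p r {suc n} d (s≤s n≤m)) u
      (All.zipWith (λ {z} (r≉z , vz) → vanishesAt-quot {p} {n} {r} {z} r≉z v d vz) (r∉ , vs)) n≤)
  roots-bound (suc n) p {nothing ∷ zs} d (∞∉ ∷ u) (v ∷ vs) (s≤s n≤) =
    roots-bound n p (λ n≤m → v (s≤s n≤m)) u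
      (All.zipWith (λ {z} (∞≉z , vz) → vanishesAt-drop {p} {n} {z} ∞≉z vz) (∞∉ , vs)) n≤

  -- Division with remainder, Bézout and Euclid's lemma.

  division : ∀ p {q n} → HasDegree q n → ∃₂ λ t r → r ≈ₚ p +ₚ t *ₚ q × DegreeBelow R r n
  division []      dq = [] , [] , ≈ₚ-refl , λ _ → refl
  division (a ∷ p) {q} {n} dq =
    let t , r , e , r< = division p dq
        lead⁻¹ , lead*lead⁻¹≈1 = inverse (coeff q n) (leading≉0 dq)
        -- `s` is `a` plus x times the remainder for the tail, so its degree is at most `n`; adding
        -- `b` times `q` cancels the coefficient of degree `n`. The sign makes `b ∷ t` the negative
        -- of the usual quotient.
        s = a ∷ r
        b = - coeff s n * lead⁻¹
        s≤ : DegreeBelow R s (suc n)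
        s≤ = λ { {suc m} (s≤s n≤m) → r< n≤m }
        open SetoidReasoning setoid
        cancel : coeff s n + b * coeff q n ≈ 0#
        cancel = begin
          coeff s n + - coeff s n * lead⁻¹ * coeff q n    ≈⟨ +-congˡ (*-assoc _ _ _) ⟩
          coeff s n + - coeff s n * (lead⁻¹ * coeff q n)  ≈⟨ +-congˡ (*-congˡ (trans (*-comm _ _) lead*lead⁻¹≈1)) ⟩
          coeff s n + - coeff s n * 1#                 ≈⟨ +-congˡ (*-identityʳ _) ⟩
          coeff s n + - coeff s n                      ≈⟨ -‿inverseʳ _ ⟩
          0#                                           ∎
        below : DegreeBelow R (s +ₚ b ·ₚ q) n
        below {m} n≤m = trans (coeff-+ s (b ·ₚ q) m) (trans (+-congˡ (coeff-· b q m))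
          (case-≤ n≤m (λ { ≡.refl → cancel })
            λ n<m → trans (+-cong (s≤ n<m) (trans (*-congˡ (above≈0 dq n<m)) (zeroʳ b))) (+-identityˡ 0#)))
    in b ∷ t , s +ₚ b ·ₚ q
     , ≈ₚ-trans (+ₚ-cong (∷-cong (sym (+-identityʳ a)) e) (≈ₚ-refl {b ·ₚ q}))
       (≈ₚ-trans (+ₚ-assoc (a ∷ p) (0# ∷ t *ₚ q) (b ·ₚ q))
                 (+ₚ-cong (≈ₚ-refl {a ∷ p}) (+ₚ-comm (0# ∷ t *ₚ q) (b ·ₚ q))))
     , λ {m} → below {m}
    where
    case-≤ : ∀ {a} {A : Set a} {m n} → m ≤ n → (m ≡ n → A) → (m < n → A) → A
    case-≤ m≤n eq lt with ℕₚ.m≤n⇒m<n∨m≡n m≤n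
    ... | inj₁ m<n = lt m<n
    ... | inj₂ m≡n = eq m≡n

  open DivisibilityProperties (CommutativeRing.*-monoid polyRing) using (∣ʳ-refl; x∣ʳy⇒x∣ʳzy)

  ∣-+ : ∀ {z p q} → z ∣ p → z ∣ q → z ∣ p +ₚ q
  ∣-+ {z} (w , e) (w′ , e′) = w +ₚ w′ , ≈ₚ-trans (*ₚ-distribʳ z w w′) (+ₚ-cong e e′)

  -- Euclid's algorithm, with `n` as the decreasing bound that ensures termination. A combination of
  -- q and r = p + t q dividing both is also a combination of p and q, and it divides p = r - t q.
  bezout : ∀ n p q → DegreeBelow R q n →
           ∃₂ λ a b → (a *ₚ p +ₚ b *ₚ q) ∣ p × (a *ₚ p +ₚ b *ₚ q) ∣ q
  bezout n p q q< with degree? F q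
  bezout n p q q< | inj₁ q≈0 = 1ₚ , []
    , ∣-resp F (≈ₚ-sym p≈) ≈ₚ-refl ∣ʳ-refl
    , ([] , ≈ₚ-sym q≈0)
    where
    p≈ : 1ₚ *ₚ p +ₚ [] ≈ₚ p
    p≈ = ≈ₚ-trans (+ₚ-identityʳ (1ₚ *ₚ p)) (*ₚ-identityˡ p)
  bezout zero p q q< | inj₂ (m , dq) = ⊥-elim (leading≉0 dq (q< z≤n))
  bezout (suc n) p q q< | inj₂ (m , dq) =
    let t , r , r≈ , r< = division p dq
        a , b , g∣q , g∣r = bezout n q r (λ n≤k → r< (ℕₚ.≤-trans m≤n n≤k))
        g≈ : a *ₚ q +ₚ b *ₚ r ≈ₚ b *ₚ p +ₚ (a +ₚ b *ₚ t) *ₚ q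
        g≈ = ≈ₚ-trans (+ₚ-cong (≈ₚ-refl {a *ₚ q}) (*ₚ-congˡ b r≈))
                      (euclid-step (CommutativeRing.commutativeSemiring polyRing) a b t p q)
        p≈ : r +ₚ (-ₚ t) *ₚ q ≈ₚ p
        p≈ = begin
          r +ₚ (-ₚ t) *ₚ q                 ≈⟨ +ₚ-cong r≈ (≈ₚ-sym (-‿distribˡ-* t q)) ⟩
          p +ₚ t *ₚ q +ₚ -ₚ (t *ₚ q)       ≈⟨ +ₚ-assoc p (t *ₚ q) (-ₚ (t *ₚ q)) ⟩
          p +ₚ (t *ₚ q +ₚ -ₚ (t *ₚ q))     ≈⟨ +ₚ-cong (≈ₚ-refl {p}) (CommutativeRing.-‿inverseʳ polyRing (t *ₚ q)) ⟩
          p +ₚ []                          ≈⟨ +ₚ-identityʳ p ⟩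
          p                                ∎
    in b , a +ₚ b *ₚ t
     , ∣-resp F g≈ p≈ (∣-+ {p = r} g∣r (x∣ʳy⇒x∣ʳzy (-ₚ t) g∣q))
     , ∣-resp F g≈ ≈ₚ-refl g∣q
    where
    open ≈ₚ-Reasoning
    open RingProperties (CommutativeRing.ring polyRing) using (-‿distribˡ-*)
    m≤n : m ≤ n
    m≤n = ℕₚ.≮⇒≥ λ n<m → leading≉0 dq (q< n<m)

  -- By coprimality the Bézout combination g = a p + b q is a unit, and `q` divides g s = a (p s) +
  -- (b s) q.
  coprime∧∣*⇒∣ : ∀ {p q s n} → HasDegree q n → Coprime p q → q ∣ p *ₚ s → q ∣ s
  coprime∧∣*⇒∣ {p} {q} {s} {n} dq cop q∣ps =
    let a , b , g∣p , g∣q = bezout (suc n) p q (above≈0 dq)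
        w , wg≈1 = cop g∣p g∣q
        g = a *ₚ p +ₚ b *ₚ q
        q∣gs : q ∣ g *ₚ s
        q∣gs = ∣-resp F (≈ₚ-refl {q}) (≈ₚ-sym (bezout-step (CommutativeRing.commutativeSemiring polyRing) a b p q s))
                 (∣-+ {q} {a *ₚ (p *ₚ s)} (x∣ʳy⇒x∣ʳzy a q∣ps) (x∣ʳy⇒x∣ʳzy (b *ₚ s) ∣ʳ-refl))
        s≈ : w *ₚ (g *ₚ s) ≈ₚ s
        s≈ = ≈ₚ-trans (≈ₚ-sym (*ₚ-assoc w g s))
               (≈ₚ-trans (*ₚ-cong wg≈1 (≈ₚ-refl {s})) (*ₚ-identityˡ s))
    in ∣-resp F (≈ₚ-refl {q}) s≈ (x∣ʳy⇒x∣ʳzy w q∣gs)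

  ∣⇒degree≤ : ∀ {p q m n} → HasDegree p m → HasDegree q n → p ∣ q → m ≤ n
  ∣⇒degree≤ {p} {q} {m} {n} dp dq (w , e) with degree? F w
  ... | inj₁ w≈0 = ⊥-elim (hasDegree⇒≉0 F dq
          (≈ₚ-trans (≈ₚ-sym e) (*ₚ-cong {w} {[]} {p} w≈0 ≈ₚ-refl)))
  ... | inj₂ (i , dw) = ≡.subst (m ≤_)
          (hasDegree-unique F (hasDegree-cong e (*ₚ-hasDegree F {w} {p} dw dp)) dq) (ℕₚ.m≤n+m m i)

  -- Degrees of equal fractions.

  open Fraction

  -- From V U′ = V′ U, Euclid's lemma gives that U and U′ divide each other, so u = u′; comparing
  -- the degrees of the two products then gives v = v′.
  ≈ᶠ⇒degrees≡ : ∀ {v u v′ u′} (f : Fraction F v u) (g : Fraction F v′ u′) →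
                _≈ᶠ_ F f g → v ≡ v′ × u ≡ u′
  ≈ᶠ⇒degrees≡ {v} {u} {v′} {u′} f g e = v≡v′ , u≡u′
    where
    u≡u′ : u ≡ u′
    u≡u′ = ℕₚ.≤-antisym
      (∣⇒degree≤ (den-degree f) (den-degree g)
        (coprime∧∣*⇒∣ {num f} (den-degree f) (coprime f) (num g , ≈ₚ-sym e)))
      (∣⇒degree≤ (den-degree g) (den-degree f)
        (coprime∧∣*⇒∣ {num g} (den-degree g) (coprime g) (num f , e)))
    v≡v′ : v ≡ v′
    v≡v′ = ℕₚ.+-cancelʳ-≡ u v v′ (≡.trans (≡.cong (v ℕ.+_) u≡u′)
      (hasDegree-unique F
        (hasDegree-cong e (*ₚ-hasDegree F {num f} {den g} (num-degree f) (den-degree g)))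
        (*ₚ-hasDegree F {num g} {den f} (num-degree g) (den-degree f))))

  -- Values of fractions in homogeneous coordinates.

  -- z = [x : y], where every z counts as [0 : 0].
  Represents : Carrier → Carrier → Maybe Carrier → Set ℓ
  Represents x y (just w) = x ≈ w * y
  Represents x y nothing  = y ≈ 0#

  ÷-represents : ∀ x y → Represents x y (_÷_ F x y)
  ÷-represents x y with _≟_ F y 0#
  ... | yes y≈0 = y≈0
  ... | no  y≉0 = let y⁻¹ , yy⁻¹≈1 = inverse y y≉0 in
    sym (trans (*-assoc x y⁻¹ y) (trans (*-congˡ (trans (*-comm y⁻¹ y) yy⁻¹≈1)) (*-identityʳ x)))

  0-represents : ∀ {x y} z → x ≈ 0# → y ≈ 0# → Represents x y z
  0-represents (just w) x≈0 y≈0 = trans x≈0 (sym (trans (*-congˡ y≈0) (zeroʳ w)))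
  0-represents nothing  x≈0 y≈0 = y≈0

  -- Coordinates of one point are proportional; the degenerate pair (0, 0) satisfies the same cross
  -- equation, which is why `Represents` may admit it.
  represents-cross : ∀ {x y x′ y′ z z′} → z ℙ¹.≈ z′ → Represents x y z → Represents x′ y′ z′ →
                     x * y′ ≈ x′ * y
  represents-cross {x} {y} {x′} {y′} (Maybe.just {w} {w′} w≈w′) x≈wy x′≈w′y′ = begin
    x * y′         ≈⟨ *-congʳ x≈wy ⟩
    w * y * y′     ≈⟨ xy∙z≈xz∙y w y y′ ⟩
    w * y′ * y     ≈⟨ *-congʳ (*-congʳ w≈w′) ⟩
    w′ * y′ * y    ≈⟨ *-congʳ x′≈w′y′ ⟨
    x′ * y         ∎
    where
    open SetoidReasoning setoid
    open CommutativeSemigroupProperties *-commutativeSemigroup using (xy∙z≈xz∙y)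
  represents-cross {x} {x′ = x′} Maybe.nothing y≈0 y′≈0 =
    trans (trans (*-congˡ y′≈0) (zeroʳ x)) (sym (trans (*-congˡ y≈0) (zeroʳ x′)))

  -- The value of p at a point of ℙ¹ as a binary form of degree n.
  form : ℕ → Poly → Maybe Carrier → Carrier
  form n p (just x) = eval p x
  form n p nothing  = coeff p n

  form-* : ∀ {n p q} → DegreeBelow R p (suc n) → DegreeBelow R q (suc n) →
           ∀ z → form (n ℕ.+ n) (p *ₚ q) z ≈ form n p z * form n q z
  form-* {n} {p} {q} dp dq (just x) = eval-* R p q x
  form-* {n} {p} {q} dp dq nothing  = *ₚ-lead {p} {q} {n} {n} dp dq

  form-difference : ∀ n p q z → form n (p +ₚ -ₚ q) z ≈ form n p z - form n q z
  form-difference n p q (just x) = trans (eval-+ R p (-ₚ q) x) (+-congˡ (eval-neg R q x))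
  form-difference n p q nothing  = trans (coeff-+ p (-ₚ q) n) (+-congˡ (coeff-neg q n))

  -- A form of degree `n` has index `suc n` in `VanishesAt`. At ∞ the hypothesis gives only
  -- coefficient `n`; the degree bound gives those above it.
  form⇒vanishesAt : ∀ {n p} → DegreeBelow R p (suc n) → ∀ z → form n p z ≈ 0# → VanishesAt p (suc n) z
  form⇒vanishesAt d (just x) e = e
  form⇒vanishesAt d nothing  e (s≤s n≤m) with ℕₚ.m≤n⇒m<n∨m≡n n≤m
  ... | inj₁ n<m    = d n<m
  ... | inj₂ ≡.refl = e

  -- Numerator and denominator are homogenised to the common degree `k`. At ∞ their coefficients of
  -- degree `k` determine the value if max(v, u) = k, and are both zero otherwise.
  value-represents : ∀ {v u k} (f : Fraction F v u) → v ≤ k → u ≤ k →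
                     ∀ z → Represents (form k (num f) z) (form k (den f) z) (evaluate f z)
  value-represents f v≤k u≤k (just x) = ÷-represents _ _
  value-represents {v} {u} f v≤k u≤k nothing with ℕₚ.<-cmp v u
  ... | tri< v<u _ _ = trans (above≈0 (num-degree f) (ℕₚ.<-≤-trans v<u u≤k)) (sym (zeroˡ _))
  ... | tri> _ _ u<v = above≈0 (den-degree f) (ℕₚ.<-≤-trans u<v v≤k)
  ... | tri≈ _ ≡.refl _ with ℕₚ.m≤n⇒m<n∨m≡n v≤k
  ...   | inj₁ v<k    = 0-represents (_÷_ F (coeff (num f) v) (coeff (den f) v))
          (above≈0 (num-degree f) v<k) (above≈0 (den-degree f) v<k)
  ...   | inj₂ ≡.refl = ÷-represents (coeff (num f) v) (coeff (den f) v)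

  agreements-bound : ∀ {v u v′ u′ k} (f : Fraction F v u) (g : Fraction F v′ u′) →
    v ≤ k → u ≤ k → v′ ≤ k → u′ ≤ k →
    ∀ {zs} → Unique ℙ¹.setoid zs → All (λ z → evaluate f z ℙ¹.≈ evaluate g z) zs →
    suc (k ℕ.+ k) ≤ length zs → _≈ᶠ_ F f g
  agreements-bound {k = k} f g v≤k u≤k v′≤k u′≤k u agree k+k< =
    RingProperties.x∙y⁻¹≈ε⇒x≈y (CommutativeRing.ring polyRing) (num f *ₚ den g) (num g *ₚ den f)
      (roots-bound (suc (k ℕ.+ k)) Δ Δ-degree u (All.map (λ {z} → vanishes z) agree) k+k<)
    where
    Δ = num f *ₚ den g +ₚ -ₚ (num g *ₚ den f)
    raise : ∀ {p n} → HasDegree p n → n ≤ k → DegreeBelow R p (suc k)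
    raise d n≤k k<m = above≈0 d (ℕₚ.≤-<-trans n≤k k<m)
    V≤ = raise (num-degree f) v≤k
    U≤ = raise (den-degree f) u≤k
    V′≤ = raise (num-degree g) v′≤k
    U′≤ = raise (den-degree g) u′≤k
    Δ-degree : DegreeBelow R Δ (suc (k ℕ.+ k))
    Δ-degree {m} k+k<m = begin
      coeff Δ m
        ≈⟨ coeff-+ (num f *ₚ den g) (-ₚ (num g *ₚ den f)) m ⟩
      coeff (num f *ₚ den g) m + coeff (-ₚ (num g *ₚ den f)) m
        ≈⟨ +-congˡ (coeff-neg (num g *ₚ den f) m) ⟩
      coeff (num f *ₚ den g) m - coeff (num g *ₚ den f) m
        ≈⟨ +-cong (*ₚ-high {num f} {den g} {k} {k} V≤ U′≤ k+k<m)
                  (-‿cong (*ₚ-high {num g} {den f} {k} {k} V′≤ U≤ k+k<m)) ⟩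
      0# - 0#
        ≈⟨ -‿inverseʳ 0# ⟩
      0# ∎
      where open SetoidReasoning setoid
    vanishes : ∀ z → evaluate f z ℙ¹.≈ evaluate g z → VanishesAt Δ (suc (k ℕ.+ k)) z
    -- By `form-*` the two sides of the cross equation are values at `z` of the forms V U′ and V′ U
    -- of degree 2k, so their difference is the value of `Δ`, also at ∞.
    vanishes z fz≈gz = form⇒vanishesAt {k ℕ.+ k} {Δ} Δ-degree z (trans
      (form-difference (k ℕ.+ k) (num f *ₚ den g) (num g *ₚ den f) z)
      (RingProperties.x≈y⇒x∙y⁻¹≈ε ring (trans (form-* {k} {num f} {den g} V≤ U′≤ z) (trans
        (represents-cross fz≈gz (value-represents f v≤k u≤k z) (value-represents g v′≤k u′≤k z))
        (sym (form-* {k} {num g} {den f} V′≤ U≤ z))))))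

  -- Permutations of the projective line and their distances.

  ℙ¹-size : HasSize ℙ¹.setoid (q ℕ.+ 1)
  ℙ¹-size = ≡.subst (HasSize ℙ¹.setoid) (ℕₚ.+-comm 1 q) (maybe-size size)

  permutation : ∀ {v u} (f : Fraction F v u) → IsPRF F f → Permutation′ (q ℕ.+ 1)
  permutation f prf = injection⇒permutation {S = ℙ¹.setoid} ℙ¹-size (proj₁ prf)

  -- If the distance h were below q - d, there would be q + 1 - h ≥ d + 2 > 2k agreements, and
  -- `agreements-bound` would identify the fractions.
  ≉ᶠ⇒hd≥ : ∀ {v u v′ u′ k d} (f : Fraction F v u) (g : Fraction F v′ u′)
    (f-prf : IsPRF F f) (g-prf : IsPRF F g) →
    v ≤ k → u ≤ k → v′ ≤ k → u′ ≤ k → k ℕ.+ k ≤ suc d →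
    ¬ _≈ᶠ_ F f g → q ℕ.∸ d ≤ hd (permutation f f-prf) (permutation g g-prf)
  ≉ᶠ⇒hd≥ {d = d} f g f-prf g-prf v≤k u≤k v′≤k u′≤k 2k≤ f≉g =
    ℕₚ.m≤n+o⇒m∸n≤o q d (ℕₚ.≮⇒≥ λ d+h<q →
      f≉g (agreements-bound f g v≤k u≤k v′≤k u′≤k
        (UniqueSetoidₚ.map⁺ (≡.setoid _) ℙ¹.setoid (to-injective {S = ℙ¹.setoid} ℙ¹-size)
          (Uniqueₚ.filter⁺ agree? (Uniqueₚ.allFin⁺ (q ℕ.+ 1))))
        (Allₚ.map⁺ (All.map (from-injective {S = ℙ¹.setoid} ℙ¹-size) (Allₚ.all-filter agree? (allFin (q ℕ.+ 1)))))
        (≡.subst (_ ≤_) (≡.sym (length-map to agreeing))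
          (ℕₚ.≤-trans (s≤s 2k≤) (ℕₚ.+-cancelˡ-≤ h _ _ (many d+h<q))))))
    where
    open Inverse ℙ¹-size using (to)
    π = permutation f f-prf
    σ = permutation g g-prf
    h = hd π σ
    agree? : Decidable (λ x → π ⟨$⟩ʳ x ≡ σ ⟨$⟩ʳ x)
    agree? x = π ⟨$⟩ʳ x Finₚ.≟ σ ⟨$⟩ʳ x
    agreeing = filter agree? (allFin (q ℕ.+ 1))
    many : d ℕ.+ h < q → h ℕ.+ suc (suc d) ≤ h ℕ.+ length agreeing
    many d+h<q = begin
      h ℕ.+ suc (suc d)           ≡⟨ ℕₚ.+-comm h (suc (suc d)) ⟩
      suc (suc d) ℕ.+ h           ≤⟨ s≤s d+h<q ⟩
      suc q                       ≡⟨ ℕₚ.+-comm 1 q ⟩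
      q ℕ.+ 1                     ≡⟨ length-tabulate {n = q ℕ.+ 1} _ ⟨
      length (allFin (q ℕ.+ 1))   ≡⟨ length-filter-complement agree? (allFin (q ℕ.+ 1)) ⟨
      h ℕ.+ length agreeing       ∎
      where open ℕₚ.≤-Reasoning

  -- Equal permutations have distance 0, whereas distinct fractions give distance at least q - d >
  -- 0.
  permutation-injective : ∀ {v u v′ u′ k d} (f : Fraction F v u) (g : Fraction F v′ u′)
    (f-prf : IsPRF F f) (g-prf : IsPRF F g) →
    v ≤ k → u ≤ k → v′ ≤ k → u′ ≤ k → k ℕ.+ k ≤ suc d → d < q →
    permutation f f-prf Perm.≈ permutation g g-prf → _≈ᶠ_ F f g
  permutation-injective {d = d} f g f-prf g-prf v≤k u≤k v′≤k u′≤k 2k≤ d<q e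
    with _≟ₚ_ F (num f *ₚ den g) (num g *ₚ den f)
  ... | yes f≈g = f≈g
  ... | no  f≉g = ⊥-elim (ℕₚ.<⇒≱ (ℕₚ.m<n⇒0<n∸m d<q) (≡.subst (q ℕ.∸ d ≤_)
    (≡.cong length (filter-none (λ x → ¬? (π ⟨$⟩ʳ x Finₚ.≟ σ ⟨$⟩ʳ x)) (All.tabulate {xs = allFin _} λ {x} _ π≢σ → π≢σ (e x))))
    (≉ᶠ⇒hd≥ f g f-prf g-prf v≤k u≤k v′≤k u′≤k 2k≤ f≉g)))
    where
    π = permutation f f-prf
    σ = permutation g g-prf

  -- The code of all PRFs with degrees at most `k`.

  module _ (k : ℕ) {N : ℕ → ℕ → ℕ}
           (N-size : ∀ v u → HasSize (DecSetoid.setoid (P F v u)) (N v u)) where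
    private
      range = upTo (suc k)
      total : ℕ → ℕ
      total v = sum (map (N v) range)
      degree : Fin (length range) → ℕ
      degree = lookup range

    -- Degrees are recorded as positions in `range`, so the triples mirror the double sum that
    -- `index` unfolds.
    PRFIndex : Set
    PRFIndex = Σ (Fin (length range)) λ a → Σ (Fin (length range)) λ b → Fin (N (degree a) (degree b))

    index : Fin (sum (map total range)) → PRFIndex
    index x = let a , y = unsum total range x in a , unsum (N (degree a)) range y

    unindex : PRFIndex → Fin (sum (map total range))
    unindex (a , b , i) = resum total range (a , resum (N (degree a)) range (b , i))

    unindex-index : ∀ x → unindex (index x) ≡ x
    unindex-index x = let a , y = unsum total range x in ≡.trans
      (≡.cong (λ z → resum total range (a , z)) (resum-unsum (N (degree a)) range y))
      (resum-unsum total range x)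

    degree≤ : ∀ a → degree a ≤ k
    degree≤ a = ℕ.s≤s⁻¹ (∈-upTo⁻ (∈-lookup {xs = range} a))

    degree-injective : ∀ {a b} → degree a ≡ degree b → a ≡ b
    degree-injective = lookup-injective (≡.setoid ℕ) (Uniqueₚ.upTo⁺ (suc k)) _ _

    prf : ((a , b , _) : PRFIndex) → DecSetoid.Carrier (P F (degree a) (degree b))
    prf (a , b , i) = Inverse.to (N-size (degree a) (degree b)) i

    -- Equal fractions have equal degrees, hence equal positions in `range`; both indices then
    -- belong to one enumeration, which is injective.
    prf-injective : ∀ {x y} → _≈ᶠ_ F (proj₁ (prf x)) (proj₁ (prf y)) → x ≡ y
    prf-injective {x@(a , b , i)} {y@(a′ , b′ , j)} e =
      let v≡v′ , u≡u′ = ≈ᶠ⇒degrees≡ (proj₁ (prf x)) (proj₁ (prf y)) e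
      in same (degree-injective v≡v′) (degree-injective u≡u′) i j e
      where
      same : ∀ {a b a′ b′} → a ≡ a′ → b ≡ b′ → ∀ i j →
             _≈ᶠ_ F (proj₁ (prf (a , b , i))) (proj₁ (prf (a′ , b′ , j))) →
             (a , b , i) ≡ (a′ , b′ , j)
      same {a} {b} ≡.refl ≡.refl i j e = ≡.cong (λ i → a , b , i)
        (to-injective {S = DecSetoid.setoid (P F (degree a) (degree b))}
          (N-size (degree a) (degree b)) e)

    PRFs-hasCode : ∀ {d} → k ℕ.+ k ≤ suc d → d < q →
                   HasCode (q ℕ.+ 1) (q ℕ.∸ d) (sum (map total range))
    PRFs-hasCode {d} 2k≤ d<q = codeword ∘ index , record
      { distinct = λ x y e → ≡.trans (≡.sym (unindex-index x))
          (≡.trans (≡.cong unindex (codeword-injective (index x) (index y) e)) (unindex-index y))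
      ; distance = λ x y → codeword-distance (index x) (index y)
      }
      where
      codeword : PRFIndex → Permutation′ (q ℕ.+ 1)
      codeword x = permutation (proj₁ (prf x)) (proj₂ (prf x))
      codeword-injective : ∀ x y → codeword x Perm.≈ codeword y → x ≡ y
      codeword-injective x@(a , b , _) y@(a′ , b′ , _) e = prf-injective
        (permutation-injective (proj₁ (prf x)) (proj₁ (prf y)) (proj₂ (prf x)) (proj₂ (prf y))
          (degree≤ a) (degree≤ b) (degree≤ a′) (degree≤ b′) 2k≤ d<q e)
      codeword-distance : ∀ x y → ¬ codeword x Perm.≈ codeword y →
                          q ℕ.∸ d ≤ hd (codeword x) (codeword y)
      codeword-distance x@(a , b , _) y@(a′ , b′ , _) πx≉πy =
        ≉ᶠ⇒hd≥ (proj₁ (prf x)) (proj₁ (prf y)) (proj₂ (prf x)) (proj₂ (prf y))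
          (degree≤ a) (degree≤ b) (degree≤ a′) (degree≤ b′) 2k≤
          -- Equal fractions have equal indices, hence the very same codeword.
          λ e → πx≉πy (λ z → ≡.cong (λ w → codeword w ⟨$⟩ʳ z) (prf-injective {x} {y} e))

-- The lower bound for `M`.

2*[m/2]≤m : ∀ m → m / 2 ℕ.+ m / 2 ≤ m
2*[m/2]≤m m = ≡.subst (_≤ m)
  (≡.trans (ℕₚ.*-comm (m / 2) 2) (≡.cong (m / 2 ℕ.+_) (ℕₚ.+-identityʳ (m / 2)))) (m/n*n≤m m 2)

open import Data.Nat using (_+_; _∸_; _≥_)
open import Data.Nat.DivMod using (_%_)

theorem3p4 : ∀ {c ℓ} (d q : ℕ) → d % 2 ≡ 1 → d ≥ 3 →
    IsPrimePower q → q ≥ d + 2 →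
    (F : FiniteField c ℓ q) →
    M (q + 1) (q ∸ d) ≥ 𝒯 F d
-- With k = (d + 1) / 2 the size of the code built by `PRFs-hasCode` is definitionally `𝒯 F d`, and
-- `M` is maximal among code sizes.
theorem3p4 d q _ _ _ q≥d+2 F = IsMaximum.maximal (proj₂ (M-exists (q + 1) (q ∸ d)))
  (PRFs-hasCode F ((d + 1) / 2) (λ v u → proj₂ (N-exists F v u))
    (≡.subst ((d + 1) / 2 + (d + 1) / 2 ≤_) (ℕₚ.+-comm d 1) (2*[m/2]≤m (d + 1)))
    (ℕₚ.≤-trans (≡.subst (suc d ≤_) (ℕₚ.+-comm 2 d) (ℕₚ.n≤1+n (suc d))) q≥d+2))
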